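{- Let $n=2p_1\cdots p_k$, where $k\ge 1$ and $p_1,\ldots,p_k$ are (not necessarily distinct, not necessarily odd) primes. Let $m$ be an odd integer with $1\le m\le n$ and let $b_1,\ldots,b_k$ be integers with $b_i$ coprime to $p_i$ for each $1\le i\le k$. If $k\ge 2$, let $S$ be the sequence in $\mathbb{Z}_n$ $$(b_1,\ p_1b_2,\ p_1p_2b_3,\ \ldots,\ p_1\cdots p_{k-1}b_k,\ \underbrace{n/2,\ldots,n/2}_{m\text{ times}},\ \underbrace{0,\ldots,0}_{n-m\text{ times}}),$$ and if $k=1$ and $p_1=p$, let $S$ be the sequence $$(b_1,\ \underbrace{p,\ldots,p}_{m\text{ times}},\ \underbrace{0,\ldots,0}_{n-m\text{ times}}).$$ Then $S$ is a $U(n)$-extremal sequence for the Gao constant.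
   Context: $\mathbb{Z}_n=\mathbb{Z}/n\mathbb{Z}$ and $U(n)$ is its group of units; integers are identified with their images in $\mathbb{Z}_n$. A sequence is a finite list $(x_1,\ldots,x_l)$ of elements of $\mathbb{Z}_n$ (repetitions allowed); a subsequence is obtained by restricting to a subset of the indices. For $A\subseteq\mathbb{Z}_n$, a subsequence of $(x_1,\ldots,x_l)$ with index set $I$ is an $A$-weighted zero-sum subsequence if $I\ne\emptyset$ and there exist $a_i\in A$ ($i\in I$) with $\sum_{i\in I}a_ix_i=0$. The $A$-weighted Gao constant $E_A(n)$ is the least positive integer $k$ such that every sequence of length $k$ in $\mathbb{Z}_n$ has an $A$-weighted zero-sum subsequence of length $n$. An $A$-extremal sequence for the Gao constant is a sequence in $\mathbb{Z}_n$ of length $E_A(n)-1$ which has no $A$-weighted zero-sum subsequence of length $n$. -}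

module Defs where

open import Algebra.Bundles using (CommutativeRing)
open import Algebra.Definitions using (Invertible)
import Algebra.Definitions.RawMonoid as RawMonoidDefinitions
open import Algebra.Structures using (IsCommutativeRing)
open import Data.Bool.Base using (if_then_else_)
open import Data.Fin.Base using (toℕ)
open import Data.Fin.Subset using (Subset; Nonempty; ∣_∣) renaming (_∈_ to _∈ₛ_)
open import Data.Integer.Base using (ℤ; +_; _+_; _*_; _-_; -_; 0ℤ; 1ℤ)
open import Data.Integer.Divisibility.Signed
  using (_∣_; divides; ∣m∣n⇒∣m+n; ∣m⇒∣-m; ∣n⇒∣m*n)
import Data.Integer.Properties as ℤₚ
open import Data.Integer.Tactic.RingSolver using (solve-∀)
import Data.List.Base as List
open import Data.Nat.Base as ℕ using (ℕ; _∸_; _≤_; _/_)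
open import Data.Nat.ListAction using (product)
open import Data.Product.Base using (∃-syntax; _×_; _,_)
open import Data.Vec.Base using (lookup)
open import Data.Vec.Functional using (Vector; toList; replicate; _++_)
open import Level using (0ℓ)
open import Relation.Binary.PropositionalEquality using (_≡_; subst; refl; sym)
open import Relation.Nullary using (¬_)
open import Relation.Unary using (Pred; _∈_)

-- ℤ/nℤ is the setoid quotient: its elements are represented by integers and
-- its equality is congruence modulo n.

infix 4 _≡_[mod_]

record _≡_[mod_] (x y : ℤ) (n : ℕ) : Set where
  constructor congruent
  field
    n∣x-y : + n ∣ x - y

module _ (n : ℕ) where

  private
    fromEq : ∀ {x y} → x ≡ y → x ≡ y [mod n ]
    fromEq {x} refl = congruent (subst (+ n ∣_) (sym (ℤₚ.+-inverseʳ x)) (divides 0ℤ refl))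

    ≈-sym : ∀ {x y} → x ≡ y [mod n ] → y ≡ x [mod n ]
    ≈-sym {x} {y} (congruent d) = congruent (subst (+ n ∣_) (eq x y) (∣m⇒∣-m d))
      where
      eq : ∀ x y → - (x - y) ≡ y - x
      eq = solve-∀

    ≈-trans : ∀ {x y z} → x ≡ y [mod n ] → y ≡ z [mod n ] → x ≡ z [mod n ]
    ≈-trans {x} {y} {z} (congruent d) (congruent e) =
      congruent (subst (+ n ∣_) (eq x y z) (∣m∣n⇒∣m+n d e))
      where
      eq : ∀ x y z → (x - y) + (y - z) ≡ x - z
      eq = solve-∀

    +-cong : ∀ {x y u v} → x ≡ y [mod n ] → u ≡ v [mod n ] →
             x + u ≡ y + v [mod n ]
    +-cong {x} {y} {u} {v} (congruent d) (congruent e) =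
      congruent (subst (+ n ∣_) (eq x y u v) (∣m∣n⇒∣m+n d e))
      where
      eq : ∀ x y u v → (x - y) + (u - v) ≡ (x + u) - (y + v)
      eq = solve-∀

    *-cong : ∀ {x y u v} → x ≡ y [mod n ] → u ≡ v [mod n ] →
             x * u ≡ y * v [mod n ]
    *-cong {x} {y} {u} {v} (congruent d) (congruent e) =
      congruent (subst (+ n ∣_) (eq x y u v) (∣m∣n⇒∣m+n (∣n⇒∣m*n u d) (∣n⇒∣m*n y e)))
      where
      eq : ∀ x y u v → u * (x - y) + y * (u - v) ≡ x * u - y * v
      eq = solve-∀

    -‿cong : ∀ {x y} → x ≡ y [mod n ] → - x ≡ - y [mod n ]
    -‿cong {x} {y} (congruent d) = congruent (subst (+ n ∣_) (eq x y) (∣m⇒∣-m d))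
      where
      eq : ∀ x y → - (x - y) ≡ - x - - y
      eq = solve-∀

    ≡-mod-isCommutativeRing : IsCommutativeRing (_≡_[mod n ]) _+_ _*_ -_ 0ℤ 1ℤ
    ≡-mod-isCommutativeRing = record
      { isRing = record
        { +-isAbelianGroup = record
          { isGroup = record
            { isMonoid = record
              { isSemigroup = record
                { isMagma = record
                  { isEquivalence = record
                    { refl  = fromEq refl
                    ; sym   = ≈-sym
                    ; trans = ≈-trans
                    }
                  ; ∙-cong = +-cong
                  }
                ; assoc = λ x y z → fromEq (ℤₚ.+-assoc x y z)
                }
              ; identity = (λ x → fromEq (ℤₚ.+-identityˡ x))
                         , (λ x → fromEq (ℤₚ.+-identityʳ x))
              }
            ; inverse = (λ x → fromEq (ℤₚ.+-inverseˡ x))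
                      , (λ x → fromEq (ℤₚ.+-inverseʳ x))
            ; ⁻¹-cong = -‿cong
            }
          ; comm = λ x y → fromEq (ℤₚ.+-comm x y)
          }
        ; *-cong = *-cong
        ; *-assoc = λ x y z → fromEq (ℤₚ.*-assoc x y z)
        ; *-identity = (λ x → fromEq (ℤₚ.*-identityˡ x))
                     , (λ x → fromEq (ℤₚ.*-identityʳ x))
        ; distrib = (λ x y z → fromEq (ℤₚ.*-distribˡ-+ x y z))
                  , (λ x y z → fromEq (ℤₚ.*-distribʳ-+ x y z))
        }
      ; *-comm = λ x y → fromEq (ℤₚ.*-comm x y)
      }

  ℤmod : CommutativeRing 0ℓ 0ℓ
  ℤmod = record { isCommutativeRing = ≡-mod-isCommutativeRing }

module _ (n : ℕ) where

  private
    module R = CommutativeRing (ℤmod n)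
  open RawMonoidDefinitions R.+-rawMonoid using (sum)

  U : Pred R.Carrier 0ℓ
  U = Invertible R._≈_ R.1# R._*_

  weightedSum : ∀ {l} → Subset l → Vector R.Carrier l → Vector R.Carrier l → R.Carrier
  weightedSum I a x = sum (λ i → if lookup I i then a i R.* x i else R.0#)

  -- A predicate A on representatives stands for the set of residue classes
  -- of the integers satisfying it; it need not respect congruence.
  IsWeightedZeroSum : Pred R.Carrier 0ℓ → ∀ {l} → Vector R.Carrier l → Subset l → Set
  IsWeightedZeroSum A {l} x I =
    Nonempty I ×
    ∃[ a ] (∀ i → i ∈ₛ I → a i ∈ A) × weightedSum I a x R.≈ R.0#

  HasWeightedZeroSumOfLength : Pred R.Carrier 0ℓ → ℕ → ∀ {l} → Vector R.Carrier l → Set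
  HasWeightedZeroSumOfLength A r {l} x =
    ∃[ I ] ∣ I ∣ ≡ r × IsWeightedZeroSum A x I

  GaoProperty : Pred R.Carrier 0ℓ → ℕ → Set
  GaoProperty A l = ∀ (x : Vector R.Carrier l) → HasWeightedZeroSumOfLength A n x

  IsGaoConstant : Pred R.Carrier 0ℓ → ℕ → Set
  IsGaoConstant A E =
    1 ≤ E × GaoProperty A E × (∀ l → 1 ≤ l → GaoProperty A l → E ≤ l)

  IsGaoExtremal : Pred R.Carrier 0ℓ → ∀ {l} → Vector R.Carrier l → Set
  IsGaoExtremal A {l} x =
    ∃[ E ] IsGaoConstant A E × l ≡ E ∸ 1 × ¬ HasWeightedZeroSumOfLength A n x

∏ : ∀ {k} → Vector ℕ k → ℕ
∏ p = product (toList p)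

-- Indices start at 0, so the i-th entry carries the product of the i primes
-- preceding position i.
leadingTerms : ∀ {k} → Vector ℕ k → Vector ℤ k → Vector ℤ k
leadingTerms p b i = + product (List.take (toℕ i) (toList p)) * b i

-- For k = 1 and n = 2p the repeated term n / 2 is p, so that case needs no
-- separate clause.
S : ∀ {k} (n m : ℕ) → Vector ℕ k → Vector ℤ k → Vector ℤ (k ℕ.+ (m ℕ.+ (n ∸ m)))
S n m p b =
  leadingTerms p b ++ (replicate m (+ (n / 2)) ++ replicate (n ∸ m) 0ℤ)

module Submission where

open import Data.Fin.Base using (zero; suc; toℕ; _↑ʳ_; splitAt)
open import Data.Fin.Subset using (Subset; Nonempty; inside; outside) renaming (_∈_ to _∈ₛ_; ∣_∣ to card; ⊤ to full)
open import Data.Fin.Subset.Properties using (∣p∣≡n⇒p≡⊤; ∈⊤)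
open import Data.Integer.Base as ℤ using (ℤ; +_; 0ℤ; 1ℤ; -1ℤ; ∣_∣)
open import Data.Integer.Coprimality using (Coprime)
open import Data.Integer.Divisibility.Signed as ℤd using (divides) renaming (_∣_ to _∣ᶻ_; _∣?_ to _∣ᶻ?_)
import Data.Integer.DivMod as ℤ÷
import Data.Integer.Properties as ℤₚ
open import Data.Integer.Tactic.RingSolver using (solve-∀)
open import Data.List.Base as List using (List; []; _∷_; _++_; map; length; filter; take; drop)
open import Data.List.Membership.Propositional using (_∈_)
import Data.List.Properties as Listₚ
open import Data.List.Relation.Binary.Permutation.Propositional as Perm using (_↭_; ↭-refl; ↭-sym; ↭-trans; ↭-prep; ↭-reflexive)
import Data.List.Relation.Binary.Permutation.Propositional.Properties as Permₚ
open import Data.List.Relation.Unary.All as All using (All; []; _∷_)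
import Data.List.Relation.Unary.All.Properties as Allₚ
open import Data.List.Relation.Unary.Any as Any using (Any; here; there)
import Data.List.Relation.Unary.Any.Properties as Anyₚ
open import Data.Nat.Base as ℕ using (ℕ; zero; suc; _*_; _+_; _≤_; z≤n; s≤s)
import Data.Nat.Coprimality as Coprimality
open import Data.Nat.Divisibility as ℕd using (_∣_)
open import Data.Nat.DivMod using (m*n/n≡m)
import Data.Nat.GCD as GCD
open import Data.Nat.ListAction using (product; sum)
open import Data.Nat.ListAction.Properties using (sum-++; sum-↭; product-↭)
open import Data.Nat.Primality using (Prime; prime⇒irreducible; prime⇒nonTrivial; prime⇒nonZero; productOfPrimes≢0; productOfPrimes≥1; prime[2]; ¬prime[1])
import Data.Nat.Properties as ℕₚ
open import Data.Product.Base using (∃₂; ∃-syntax; _×_; _,_; proj₁; proj₂)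
open import Data.Sum.Base using (_⊎_; inj₁; inj₂)
open import Data.Vec.Base as Vec using (here; there)
open import Data.Vec.Functional as Vector using (Vector; replicate)
import Data.Vec.Functional.Properties as Vectorₚ
open import Function.Base using (_∘_)
open import Relation.Binary.PropositionalEquality using (_≡_; _≢_; refl; sym; trans; cong; cong₂; subst; subst₂; module ≡-Reasoning)
open import Relation.Nullary using (¬_; Dec; yes; no; contradiction)
open import Relation.Nullary.Decidable using (¬?; decidable-stable; _⊎-dec_; _×-dec_)
open import Relation.Unary using (Decidable)
open import Defs

-- The Gao constant is n + Ω(n) = n + k + 1.
--
-- Lower bound: modulo p₁, then p₁p₂, ..., a zero-sum subsequence of length n
-- of S cannot use any leading term, so it consists of all the other terms;
-- its sum is then n/2 times a sum of m odd weights, which is odd.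
--
-- Upper bound: if for each odd prime p ∣ n two chosen terms are prime to p,
-- and if some chosen term is odd and the chosen terms have even sum, then unit
-- weights exist modulo every prime, hence modulo n. The induction on
-- the number of prime factors therefore concerns the primes p with
-- few terms nonzero modulo p. At most one such term is dropped; two such terms
-- (p odd) are merged, with weights, into one block divisible by p. Either way
-- one block and one prime factor are lost, and everything is divided by p.
-- Once no such prime is left, three blocks nonzero modulo each odd prime are
-- set aside together with the merged ones; enough single terms remain to
-- reach total length n with an even sum, after dropping at most one block.

-- Units modulo d

record Unit (d a : ℤ) : Set where
  constructor unit
  field
    inverse   : ℤ
    isInverse : d ∣ᶻ a ℤ.* inverse ℤ.- 1ℤ

∣x-x : ∀ {d} x → d ∣ᶻ x ℤ.- x
∣x-x {d} x = subst (d ∣ᶻ_) (sym (ℤₚ.+-inverseʳ x)) (divides 0ℤ refl)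

unit-1 : ∀ {d} → Unit d 1ℤ
unit-1 = unit 1ℤ (divides 0ℤ refl)

unit-weaken : ∀ {d e a} → d ∣ᶻ e → Unit e a → Unit d a
unit-weaken d∣e (unit b h) = unit b (ℤd.∣-trans d∣e h)

-- The product `(a b - 1)(a c - 1)` of the two error terms is divisible by `d e`, and its negative
-- has the form `a * (...) - 1`. The case where `e` divides `d` is included, which is what powers of
-- a prime call for.
unit-* : ∀ {d e a} → Unit d a → Unit e a → Unit (d ℤ.* e) a
unit-* {d} {e} {a} (unit b (divides q h)) (unit c (divides r h′)) =
  unit (b ℤ.+ c ℤ.- a ℤ.* b ℤ.* c) (divides (ℤ.- (q ℤ.* r)) (begin
    a ℤ.* (b ℤ.+ c ℤ.- a ℤ.* b ℤ.* c) ℤ.- 1ℤ        ≡⟨ eq₁ a b c ⟩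
    ℤ.- ((a ℤ.* b ℤ.- 1ℤ) ℤ.* (a ℤ.* c ℤ.- 1ℤ))      ≡⟨ cong₂ (λ u v → ℤ.- (u ℤ.* v)) h h′ ⟩
    ℤ.- ((q ℤ.* d) ℤ.* (r ℤ.* e))                    ≡⟨ eq₂ q d r e ⟩
    ℤ.- (q ℤ.* r) ℤ.* (d ℤ.* e)                      ∎))
  where
  open ≡-Reasoning
  eq₁ : ∀ a b c → a ℤ.* (b ℤ.+ c ℤ.- a ℤ.* b ℤ.* c) ℤ.- 1ℤ ≡ ℤ.- ((a ℤ.* b ℤ.- 1ℤ) ℤ.* (a ℤ.* c ℤ.- 1ℤ))
  eq₁ = solve-∀
  eq₂ : ∀ q d r e → ℤ.- ((q ℤ.* d) ℤ.* (r ℤ.* e)) ≡ ℤ.- (q ℤ.* r) ℤ.* (d ℤ.* e)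
  eq₂ = solve-∀

unit-cong : ∀ {d a a′} → d ∣ᶻ a′ ℤ.- a → Unit d a → Unit d a′
unit-cong {d} {a} {a′} h (unit b g) =
  unit b (subst (d ∣ᶻ_) (eq a a′ b) (ℤd.∣m∣n⇒∣m+n (ℤd.∣m⇒∣m*n b h) g))
  where
  eq : ∀ a a′ b → (a′ ℤ.- a) ℤ.* b ℤ.+ (a ℤ.* b ℤ.- 1ℤ) ≡ a′ ℤ.* b ℤ.- 1ℤ
  eq = solve-∀

unit-product : ∀ {d a b} → Unit d a → Unit d b → Unit d (a ℤ.* b)
unit-product {d} {a} {b} (unit a′ h) (unit b′ g) =
  unit (a′ ℤ.* b′) (subst (d ∣ᶻ_) (eq a a′ b b′) (ℤd.∣m∣n⇒∣m+n (ℤd.∣m⇒∣m*n (b ℤ.* b′) h) g))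
  where
  eq : ∀ a a′ b b′ → (a ℤ.* a′ ℤ.- 1ℤ) ℤ.* (b ℤ.* b′) ℤ.+ (b ℤ.* b′ ℤ.- 1ℤ) ≡ a ℤ.* b ℤ.* (a′ ℤ.* b′) ℤ.- 1ℤ
  eq = solve-∀

unit-cancel : ∀ {d a x} → Unit d a → d ∣ᶻ a ℤ.* x → d ∣ᶻ x
unit-cancel {d} {a} {x} (unit b h) g =
  subst (d ∣ᶻ_) (eq a b x) (ℤd.∣m∣n⇒∣m-n (ℤd.∣n⇒∣m*n b g) (ℤd.∣n⇒∣m*n x h))
  where
  eq : ∀ a b x → b ℤ.* (a ℤ.* x) ℤ.- x ℤ.* (a ℤ.* b ℤ.- 1ℤ) ≡ x
  eq = solve-∀

∣∣≡sgn* : ∀ x → ∃[ s ] + ∣ x ∣ ≡ s ℤ.* x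
∣∣≡sgn* (+ n)      = 1ℤ , sym (ℤₚ.*-identityˡ (+ n))
∣∣≡sgn* ℤ.-[1+ n ] = -1ℤ , sym (ℤₚ.-1*i≡-i ℤ.-[1+ n ])

-- Bézout for `∣ x ∣` and `d`; the sign `s` with `∣ x ∣ = s x` is then absorbed into the inverse.
coprime⇒unit : ∀ {x d} → Coprimality.Coprime ∣ x ∣ d → Unit (+ d) x
coprime⇒unit {x} {d} cop with ∣∣≡sgn* x | Coprimality.coprime-Bézout cop
... | s , eq | GCD.Bézout.+- u v h = unit (s ℤ.* + u) (divides (+ v) (begin
    x ℤ.* (s ℤ.* + u) ℤ.- 1ℤ          ≡⟨ e₁ x s (+ u) ⟩
    + u ℤ.* (s ℤ.* x) ℤ.- 1ℤ          ≡⟨ cong (λ y → + u ℤ.* y ℤ.- 1ℤ) (sym eq) ⟩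
    + u ℤ.* + ∣ x ∣ ℤ.- 1ℤ             ≡⟨ cong (ℤ._- 1ℤ) (sym (ℤₚ.pos-* u ∣ x ∣)) ⟩
    + (u * ∣ x ∣) ℤ.- 1ℤ               ≡⟨ cong (λ y → + y ℤ.- 1ℤ) (sym h) ⟩
    + (1 + v * d) ℤ.- 1ℤ               ≡⟨ cong (ℤ._- 1ℤ) (ℤₚ.pos-+ 1 (v * d)) ⟩
    1ℤ ℤ.+ + (v * d) ℤ.- 1ℤ            ≡⟨ e₂ (+ (v * d)) ⟩
    + (v * d)                          ≡⟨ ℤₚ.pos-* v d ⟩
    + v ℤ.* + d                        ∎))
  where
  open ≡-Reasoning
  e₁ : ∀ x s u → x ℤ.* (s ℤ.* u) ℤ.- 1ℤ ≡ u ℤ.* (s ℤ.* x) ℤ.- 1ℤ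
  e₁ = solve-∀
  e₂ : ∀ y → 1ℤ ℤ.+ y ℤ.- 1ℤ ≡ y
  e₂ = solve-∀
... | s , eq | GCD.Bézout.-+ u v h = unit (s ℤ.* (ℤ.- + u)) (divides (ℤ.- + v) (begin
    x ℤ.* (s ℤ.* (ℤ.- + u)) ℤ.- 1ℤ    ≡⟨ e₁ x s (+ u) ⟩
    ℤ.- (1ℤ ℤ.+ + u ℤ.* (s ℤ.* x))    ≡⟨ cong (λ y → ℤ.- (1ℤ ℤ.+ + u ℤ.* y)) (sym eq) ⟩
    ℤ.- (1ℤ ℤ.+ + u ℤ.* + ∣ x ∣)       ≡⟨ cong (λ y → ℤ.- (1ℤ ℤ.+ y)) (sym (ℤₚ.pos-* u ∣ x ∣)) ⟩
    ℤ.- + (1 + u * ∣ x ∣)              ≡⟨ cong (λ y → ℤ.- + y) h ⟩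
    ℤ.- + (v * d)                      ≡⟨ cong ℤ.-_ (ℤₚ.pos-* v d) ⟩
    ℤ.- (+ v ℤ.* + d)                  ≡⟨ ℤₚ.neg-distribˡ-* (+ v) (+ d) ⟩
    (ℤ.- + v) ℤ.* + d                  ∎))
  where
  open ≡-Reasoning
  e₁ : ∀ x s u → x ℤ.* (s ℤ.* (ℤ.- u)) ℤ.- 1ℤ ≡ ℤ.- (1ℤ ℤ.+ u ℤ.* (s ℤ.* x))
  e₁ = solve-∀

prime-∤⇒unit : ∀ {p x} → Prime p → ¬ (+ p ∣ᶻ x) → Unit (+ p) x
prime-∤⇒unit {p} {x} pp ∤x = coprime⇒unit {x} (λ {i} → cop {i})
  where
  cop : Coprimality.Coprime ∣ x ∣ p
  cop (d∣x , d∣p) with prime⇒irreducible pp d∣p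
  ... | inj₁ d≡1 = d≡1
  ... | inj₂ refl = contradiction (ℤd.∣ᵤ⇒∣ d∣x) ∤x

prime-∤1 : ∀ {p} → Prime p → ¬ (+ p ∣ᶻ 1ℤ)
prime-∤1 pp h with ℕd.∣1⇒≡1 (ℤd.∣⇒∣ᵤ h)
... | refl = ¬prime[1] pp

unit⇒∤ : ∀ {p x} → Prime p → Unit (+ p) x → ¬ (+ p ∣ᶻ x)
unit⇒∤ {p} {x} pp (unit b h) ∣x =
  prime-∤1 pp (subst (+ p ∣ᶻ_) (eq x b) (ℤd.∣m∣n⇒∣m-n (ℤd.∣m⇒∣m*n b ∣x) h))
  where
  eq : ∀ x b → x ℤ.* b ℤ.- (x ℤ.* b ℤ.- 1ℤ) ≡ 1ℤ
  eq = solve-∀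

2∤⇒2∣-1 : ∀ {x} → ¬ (+ 2 ∣ᶻ x) → + 2 ∣ᶻ x ℤ.- 1ℤ
2∤⇒2∣-1 {x} ∤x with x ℤ÷.%ℕ 2 | ℤ÷.n%ℕd<d x 2 | ℤ÷.a≡a%ℕn+[a/ℕn]*n x 2
... | 0 | _ | eq = contradiction (divides (x ℤ÷./ℕ 2) (trans eq (ℤₚ.+-identityˡ _))) ∤x
... | 1 | _ | eq = divides (x ℤ÷./ℕ 2) (trans (cong (ℤ._- 1ℤ) eq) (e _))
  where
  e : ∀ y → 1ℤ ℤ.+ y ℤ.- 1ℤ ≡ y
  e = solve-∀
... | suc (suc _) | s≤s (s≤s ()) | _

odd+odd : ∀ {x y} → ¬ (+ 2 ∣ᶻ x) → ¬ (+ 2 ∣ᶻ y) → + 2 ∣ᶻ x ℤ.+ y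
odd+odd {x} {y} ∤x ∤y = subst (+ 2 ∣ᶻ_) (eq x y)
  (ℤd.∣m∣n⇒∣m+n (ℤd.∣m∣n⇒∣m+n (2∤⇒2∣-1 ∤x) (2∤⇒2∣-1 ∤y)) ℤd.∣-refl)
  where
  eq : ∀ x y → (x ℤ.- 1ℤ) ℤ.+ (y ℤ.- 1ℤ) ℤ.+ + 2 ≡ x ℤ.+ y
  eq = solve-∀

-- If p ∣ a then p ∤ d, as a is a unit modulo d; so p ∤ a + d.
lift-unit : ∀ {p d a} → Prime p → Unit d a → ∃[ a′ ] Unit (+ p ℤ.* d) a′ × d ∣ᶻ a′ ℤ.- a
lift-unit {p} {d} {a} pp u with + p ∣ᶻ? a
... | no ∤a = a , unit-* (prime-∤⇒unit pp ∤a) u , ∣x-x a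
... | yes ∣a = a ℤ.+ d , unit-* (prime-∤⇒unit pp ∤a+d) (unit-cong d∣ u) , d∣
  where
  d∣ : d ∣ᶻ a ℤ.+ d ℤ.- a
  d∣ = subst (d ∣ᶻ_) (eq a d) ℤd.∣-refl
    where
    eq : ∀ a d → d ≡ a ℤ.+ d ℤ.- a
    eq = solve-∀
  ∤a+d : ¬ (+ p ∣ᶻ a ℤ.+ d)
  ∤a+d h = unit⇒∤ pp (unit-weaken (ℤd.∣m+n∣m⇒∣n h ∣a) u) ∣a

-- The primes are added one at a time by `lift-unit`. Each correction is a multiple of the modulus
-- reached so far, hence of `p`. This is how a weight chosen modulo `p` alone becomes a legitimate
-- weight modulo the whole product.
lift-units : ∀ {a} p ps → All Prime ps → Unit (+ p) a →
             ∃[ a′ ] Unit (+ product (p ∷ ps)) a′ × + p ∣ᶻ a′ ℤ.- a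
lift-units {a} p [] [] u =
  a , subst (λ n → Unit (+ n) a) (sym (ℕₚ.*-identityʳ p)) u , ∣x-x a
lift-units {a} p (q ∷ ps) (pq ∷ pps) u =
  let a₁ , u₁ , h₁ = lift-units p ps pps u
      a₂ , u₂ , h₂ = lift-unit pq u₁
  in  a₂ , subst (λ d → Unit d a₂) eq u₂ ,
      subst (+ p ∣ᶻ_) (e a a₁ a₂) (ℤd.∣m∣n⇒∣m+n (ℤd.∣-trans p∣ h₂) h₁)
  where
  e : ∀ a a₁ a₂ → (a₂ ℤ.- a₁) ℤ.+ (a₁ ℤ.- a) ≡ a₂ ℤ.- a
  e = solve-∀
  p∣ : + p ∣ᶻ + product (p ∷ ps)
  p∣ = subst (+ p ∣ᶻ_) (sym (ℤₚ.pos-* p (product ps))) (ℤd.∣m⇒∣m*n (+ product ps) ℤd.∣-refl)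
  eq : + q ℤ.* + product (p ∷ ps) ≡ + product (p ∷ q ∷ ps)
  eq = trans (sym (ℤₚ.pos-* q (product (p ∷ ps)))) (cong +_ (begin
    q * (p * product ps)  ≡⟨ sym (ℕₚ.*-assoc q p (product ps)) ⟩
    q * p * product ps    ≡⟨ cong (_* product ps) (ℕₚ.*-comm q p) ⟩
    p * q * product ps    ≡⟨ ℕₚ.*-assoc p q (product ps) ⟩
    p * (q * product ps)  ∎))
    where open ≡-Reasoning

-- Unit-weighted sums of all terms of a list

data Comb (d : ℤ) : List ℤ → ℤ → Set where
  []  : Comb d [] 0ℤ
  _∷_ : ∀ {a x xs v} → Unit d a → Comb d xs v → Comb d (x ∷ xs) (a ℤ.* x ℤ.+ v)

Solvable : ℤ → List ℤ → Set
Solvable d xs = ∃[ v ] Comb d xs v × d ∣ᶻ v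

sumᶻ : List ℤ → ℤ
sumᶻ = List.foldr ℤ._+_ 0ℤ

comb-ones : ∀ {d} xs → Comb d xs (sumᶻ xs)
comb-ones []       = []
comb-ones {d} (x ∷ xs) =
  subst (λ y → Comb d (x ∷ xs) (y ℤ.+ sumᶻ xs)) (ℤₚ.*-identityˡ x) (unit-1 ∷ comb-ones xs)

comb-↭ : ∀ {d xs ys v} → xs ↭ ys → Comb d xs v → Comb d ys v
comb-↭ Perm.refl c = c
comb-↭ (Perm.prep x σ) (u ∷ c) = u ∷ comb-↭ σ c
comb-↭ {d} (Perm.swap {xs} {ys} x y σ) (_∷_ {a} u (_∷_ {b} {v = v} w c)) =
  subst (Comb d (y ∷ x ∷ ys)) (eq (a ℤ.* x) (b ℤ.* y) v) (w ∷ u ∷ comb-↭ σ c)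
  where
  eq : ∀ r s v → s ℤ.+ (r ℤ.+ v) ≡ r ℤ.+ (s ℤ.+ v)
  eq = solve-∀
comb-↭ (Perm.trans σ τ) c = comb-↭ τ (comb-↭ σ c)

comb-unit-* : ∀ {d e xs v} → e ∣ᶻ d → Comb d xs v → Comb (e ℤ.* d) xs v
comb-unit-* e∣d []      = []
comb-unit-* e∣d (u ∷ c) = unit-* (unit-weaken e∣d u) u ∷ comb-unit-* e∣d c

-- Chinese remaindering and Hensel lifting of weighted sums.

crt : ∀ {d e a c} → Unit e d → Unit d a → Unit e c →
      ∃[ b ] Unit (e ℤ.* d) b × d ∣ᶻ b ℤ.- a × e ∣ᶻ b ℤ.- c
crt {d} {e} {a} {c} (unit f h) u w = b , unit-* (unit-cong e∣ w) (unit-cong d∣ u) , d∣ , e∣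
  where
  -- Since `f` inverts `d` modulo `e`, the correction vanishes modulo `d` and is `c - a` modulo `e`.
  b = a ℤ.+ d ℤ.* f ℤ.* (c ℤ.- a)
  d∣ : d ∣ᶻ b ℤ.- a
  d∣ = divides (f ℤ.* (c ℤ.- a)) (eq d f a c)
    where
    eq : ∀ d f a c → a ℤ.+ d ℤ.* f ℤ.* (c ℤ.- a) ℤ.- a ≡ f ℤ.* (c ℤ.- a) ℤ.* d
    eq = solve-∀
  e∣ : e ∣ᶻ b ℤ.- c
  e∣ = subst (e ∣ᶻ_) (eq d f a c) (ℤd.∣m⇒∣m*n (c ℤ.- a) h)
    where
    eq : ∀ d f a c → (d ℤ.* f ℤ.- 1ℤ) ℤ.* (c ℤ.- a) ≡ a ℤ.+ d ℤ.* f ℤ.* (c ℤ.- a) ℤ.- c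
    eq = solve-∀

∣-step : ∀ {d} a b x u v → d ∣ᶻ b ℤ.- a → d ∣ᶻ u ℤ.- v → d ∣ᶻ (b ℤ.* x ℤ.+ u) ℤ.- (a ℤ.* x ℤ.+ v)
∣-step {d} a b x u v h g = subst (d ∣ᶻ_) (eq a b x u v) (ℤd.∣m∣n⇒∣m+n (ℤd.∣m⇒∣m*n x h) g)
  where
  eq : ∀ a b x u v → (b ℤ.- a) ℤ.* x ℤ.+ (u ℤ.- v) ≡ (b ℤ.* x ℤ.+ u) ℤ.- (a ℤ.* x ℤ.+ v)
  eq = solve-∀

comb-crt-∷ : ∀ {d e x xs v w a c} →
             ∃[ b ] Unit (e ℤ.* d) b × d ∣ᶻ b ℤ.- a × e ∣ᶻ b ℤ.- c →
             ∃[ u ] Comb (e ℤ.* d) xs u × d ∣ᶻ u ℤ.- v × e ∣ᶻ u ℤ.- w →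
             ∃[ u ] Comb (e ℤ.* d) (x ∷ xs) u × d ∣ᶻ u ℤ.- (a ℤ.* x ℤ.+ v) × e ∣ᶻ u ℤ.- (c ℤ.* x ℤ.+ w)
comb-crt-∷ {x = x} {v = v} {w} {a} {c} (b , υ , b-a , b-c) (u , κ , u-v , u-w) =
  b ℤ.* x ℤ.+ u , υ ∷ κ , ∣-step a b x u v b-a u-v , ∣-step c b x u w b-c u-w

comb-crt : ∀ {d e xs v w} → Unit e d → Comb d xs v → Comb e xs w →
           ∃[ u ] Comb (e ℤ.* d) xs u × d ∣ᶻ u ℤ.- v × e ∣ᶻ u ℤ.- w
comb-crt δ []       []        = 0ℤ , [] , divides 0ℤ refl , divides 0ℤ refl
comb-crt δ (α ∷ c) (β ∷ c′) = comb-crt-∷ (crt δ α β) (comb-crt δ c c′)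

∣-of-difference : ∀ {d} u v → d ∣ᶻ u ℤ.- v → d ∣ᶻ v → d ∣ᶻ u
∣-of-difference {d} u v h g = subst (d ∣ᶻ_) (eq u v) (ℤd.∣m∣n⇒∣m+n h g)
  where
  eq : ∀ u v → (u ℤ.- v) ℤ.+ v ≡ u
  eq = solve-∀

coprime-*-∣ : ∀ {d e x} → Unit e d → d ∣ᶻ x → e ∣ᶻ x → e ℤ.* d ∣ᶻ x
coprime-*-∣ {d} {e} δ (divides q refl) e∣x =
  ℤd.*-monoˡ-∣ d (unit-cancel δ (subst (e ∣ᶻ_) (ℤₚ.*-comm q d) e∣x))

solvable-crt : ∀ {d e xs} → Unit e d → Solvable d xs → Solvable e xs → Solvable (e ℤ.* d) xs
solvable-crt δ (v , c , d∣v) (w , c′ , e∣w) with comb-crt δ c c′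
... | u , c″ , u-v , u-w =
  u , c″ , coprime-*-∣ δ (∣-of-difference u v u-v d∣v) (∣-of-difference u w u-w e∣w)

-- Adding `t d` to the weight of one term `x` keeps it a unit modulo `d`, hence modulo `e d` because
-- `e` divides `d`, and moves the sum by `t d x`. The parameter `t` stays free for `solvable-hensel`
-- to choose.
comb-shift : ∀ {d e xs v} → e ∣ᶻ d → Any (Unit e) xs → Comb d xs v →
             ∃[ x ] Unit e x × (∀ t → Comb (e ℤ.* d) xs (v ℤ.+ d ℤ.* (t ℤ.* x)))
comb-shift {d} {e} {xs = x ∷ xs} e∣d (here ux) (_∷_ {a} {v = v} u c) = x , ux , λ t →
  subst (Comb (e ℤ.* d) (x ∷ xs)) (eq a d t x v)
    (unit-* (unit-weaken e∣d (u′ t)) (u′ t) ∷ comb-unit-* e∣d c)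
  where
  eq : ∀ a d t x v → (a ℤ.+ t ℤ.* d) ℤ.* x ℤ.+ v ≡ a ℤ.* x ℤ.+ v ℤ.+ d ℤ.* (t ℤ.* x)
  eq = solve-∀
  eq′ : ∀ a td → a ℤ.+ td ℤ.- a ≡ td
  eq′ = solve-∀
  u′ : ∀ t → Unit d (a ℤ.+ t ℤ.* d)
  u′ t = unit-cong (divides t (eq′ a (t ℤ.* d))) u
comb-shift {d} {e} {xs = y ∷ xs} e∣d (there any) (_∷_ {a} {v = v} u c) with comb-shift e∣d any c
... | x , ux , f = x , ux , λ t →
  subst (Comb (e ℤ.* d) (y ∷ xs)) (eq (a ℤ.* y) v (d ℤ.* (t ℤ.* x))) (unit-* (unit-weaken e∣d u) u ∷ f t)
  where
  eq : ∀ r v w → r ℤ.+ (v ℤ.+ w) ≡ r ℤ.+ v ℤ.+ w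
  eq = solve-∀

solvable-hensel : ∀ {d e xs} → e ∣ᶻ d → Any (Unit e) xs → Solvable d xs → Solvable (e ℤ.* d) xs
solvable-hensel {d} {e} e∣d any (v , c , divides q refl) with comb-shift e∣d any c
-- With `v = q d` and `y` inverse to `x` modulo `e`, the choice `t = - q y` turns the sum into
-- `- q (x y - 1) d`.
... | x , unit y h , f = _ , f (ℤ.- (q ℤ.* y)) , subst (e ℤ.* d ∣ᶻ_) (eq q x y d) (ℤd.∣n⇒∣m*n (ℤ.- q) (ℤd.*-monoˡ-∣ d h))
  where
  eq : ∀ q x y d → ℤ.- q ℤ.* ((x ℤ.* y ℤ.- 1ℤ) ℤ.* d) ≡ q ℤ.* d ℤ.+ d ℤ.* (ℤ.- (q ℤ.* y) ℤ.* x)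
  eq = solve-∀

-- The first component serves Chinese remaindering, when `p` is coprime to the product of the other
-- factors; the second provides the term to shift in Hensel lifting, when `p` divides that product.
LocallySolvable : List ℤ → ℕ → Set
LocallySolvable xs p = Solvable (+ p) xs × Any (λ x → ¬ (+ p ∣ᶻ x)) xs

solvable-product : ∀ {xs ps} → All Prime ps → All (LocallySolvable xs) ps → Solvable (+ product ps) xs
solvable-product {xs} [] [] = _ , comb-ones xs , divides (sumᶻ xs) (sym (ℤₚ.*-identityʳ (sumᶻ xs)))
solvable-product {xs} {p ∷ ps} (pp ∷ pps) ((sol , any) ∷ locs) =
  subst (λ d → Solvable d xs) (sym (ℤₚ.pos-* p (product ps))) step
  where
  ih : Solvable (+ product ps) xs
  ih = solvable-product pps locs
  step : Solvable (+ p ℤ.* + product ps) xs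
  step with + p ∣ᶻ? + product ps
  ... | yes p∣d = solvable-hensel p∣d (Any.map (prime-∤⇒unit pp) any) ih
  ... | no  p∤d = solvable-crt (prime-∤⇒unit pp p∤d) ih sol

-- Solvability modulo a single prime.

prime-∤2 : ∀ {p} → Prime p → p ≢ 2 → ¬ (+ p ∣ᶻ + 2)
prime-∤2 pp p≢2 h with prime⇒irreducible prime[2] (ℤd.∣⇒∣ᵤ h)
... | inj₁ refl = ¬prime[1] pp
... | inj₂ p≡2  = p≢2 p≡2

-- For an odd prime p, one of the weights 1 and 2 keeps c + a x nonzero mod p.
nonzero-translate : ∀ {p x} → Prime p → p ≢ 2 → ¬ (+ p ∣ᶻ x) → ∀ c →
                    ∃[ a ] Unit (+ p) a × ¬ (+ p ∣ᶻ c ℤ.+ a ℤ.* x)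
nonzero-translate {p} {x} pp p≢2 ∤x c with + p ∣ᶻ? c ℤ.+ 1ℤ ℤ.* x
... | no  ∤c+x = 1ℤ , unit-1 , ∤c+x
... | yes ∣c+x = + 2 , prime-∤⇒unit pp (prime-∤2 pp p≢2) , λ h →
    ∤x (subst (+ p ∣ᶻ_) (eq c x) (ℤd.∣m∣n⇒∣m-n h ∣c+x))
  where
  eq : ∀ c x → c ℤ.+ + 2 ℤ.* x ℤ.- (c ℤ.+ 1ℤ ℤ.* x) ≡ x
  eq = solve-∀

-- The weight is `- w / y` modulo `p`, a unit because `w` is nonzero. It serves both to close a sum
-- and to merge two blocks.
cancelling-weight : ∀ {p w y} → Prime p → ¬ (+ p ∣ᶻ w) → ¬ (+ p ∣ᶻ y) →
                    ∃[ b ] Unit (+ p) b × + p ∣ᶻ w ℤ.+ b ℤ.* y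
cancelling-weight {p} {w} {y} pp ∤w ∤y with prime-∤⇒unit pp ∤y
... | unit z h = ℤ.- (w ℤ.* z) , prime-∤⇒unit pp ∤b , ∣sum
  where
  eq : ∀ w z y → ℤ.- w ℤ.* (y ℤ.* z ℤ.- 1ℤ) ≡ w ℤ.+ ℤ.- (w ℤ.* z) ℤ.* y
  eq = solve-∀
  ∣sum : + p ∣ᶻ w ℤ.+ ℤ.- (w ℤ.* z) ℤ.* y
  ∣sum = subst (+ p ∣ᶻ_) (eq w z y) (ℤd.∣n⇒∣m*n (ℤ.- w) h)
  ∤b : ¬ (+ p ∣ᶻ ℤ.- (w ℤ.* z))
  ∤b g = ∤w (ℤd.∣m+n∣n⇒∣m ∣sum (ℤd.∣m⇒∣m*n y g))

solvable-pair : ∀ {d a b} x y zs → Unit d a → Unit d b → d ∣ᶻ sumᶻ zs ℤ.+ a ℤ.* x ℤ.+ b ℤ.* y →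
                Solvable d (x ∷ y ∷ zs)
solvable-pair {d} {a} {b} x y zs ua ub h =
  a ℤ.* x ℤ.+ (b ℤ.* y ℤ.+ sumᶻ zs) , ua ∷ ub ∷ comb-ones zs ,
  subst (d ∣ᶻ_) (eq (sumᶻ zs) (a ℤ.* x) (b ℤ.* y)) h
  where
  eq : ∀ c s t → c ℤ.+ s ℤ.+ t ≡ s ℤ.+ (t ℤ.+ c)
  eq = solve-∀

-- All of `zs` gets weight 1. The weight of `x` is chosen to leave a nonzero partial sum, which a
-- unit weight on `y` can then cancel.
solvable-odd : ∀ {p x y zs} → Prime p → p ≢ 2 → ¬ (+ p ∣ᶻ x) → ¬ (+ p ∣ᶻ y) →
               Solvable (+ p) (x ∷ y ∷ zs)
solvable-odd {p} {x} {y} {zs} pp p≢2 ∤x ∤y =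
  let a , ua , ∤w = nonzero-translate pp p≢2 ∤x (sumᶻ zs)
      b , ub , h  = cancelling-weight {w = sumᶻ zs ℤ.+ a ℤ.* x} {y} pp ∤w ∤y
  in  solvable-pair {+ p} {a} {b} x y zs ua ub h

solvable-even : ∀ {xs} → + 2 ∣ᶻ sumᶻ xs → Solvable (+ 2) xs
solvable-even {xs} h = sumᶻ xs , comb-ones xs , h

solvable-↭ : ∀ {d xs ys} → xs ↭ ys → Solvable d xs → Solvable d ys
solvable-↭ σ (v , c , h) = v , comb-↭ σ c , h

-- Blocks

-- A block (s , x) stands for s + 1 terms of the sequence, combined with unit weights into the value x.
Block : Set
Block = ℕ × ℤ

size : Block → ℕ
size b = suc (proj₁ b)

value : Block → ℤ
value = proj₂

-- The total size is the number of blocks plus the excess; merging two blocks raises the excess by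
-- one and keeps the total size.
totalSize excess : List Block → ℕ
totalSize bs = sum (map size bs)
excess    bs = sum (map proj₁ bs)

-- Unlike `Comb`, blocks may be left out. The index `l` adds up block sizes, so it counts terms of
-- the original sequence and is unaffected by merging.
data Rep (d : ℤ) : List Block → ℕ → ℤ → Set where
  []   : Rep d [] 0 0ℤ
  skip : ∀ {b bs l v} → Rep d bs l v → Rep d (b ∷ bs) l v
  _∷_  : ∀ {a s x bs l v} → Unit d a → Rep d bs l v → Rep d ((s , x) ∷ bs) (suc s + l) (a ℤ.* x ℤ.+ v)

Reaches : ℤ → List Block → ℕ → Set
Reaches d bs l = ∃[ v ] Rep d bs l v × d ∣ᶻ v

+-swap : ∀ a b c → a + (b + c) ≡ b + (a + c)
+-swap a b c = trans (sym (ℕₚ.+-assoc a b c)) (trans (cong (_+ c) (ℕₚ.+-comm a b)) (ℕₚ.+-assoc b a c))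

rep-↭ : ∀ {d bs cs l v} → bs ↭ cs → Rep d bs l v → Rep d cs l v
rep-↭ Perm.refl r = r
rep-↭ (Perm.prep b σ) (skip r) = skip (rep-↭ σ r)
rep-↭ (Perm.prep b σ) (u ∷ r)  = u ∷ rep-↭ σ r
rep-↭ (Perm.swap b c σ) (skip (skip r)) = skip (skip (rep-↭ σ r))
rep-↭ (Perm.swap b c σ) (skip (u ∷ r))  = u ∷ skip (rep-↭ σ r)
rep-↭ (Perm.swap b c σ) (u ∷ skip r)    = skip (u ∷ rep-↭ σ r)
rep-↭ {d} (Perm.swap {ys = ys} b@(s , x) c@(t , y) σ) (_∷_ {a} u (_∷_ {a′} {l = l} {v} u′ r)) =
  subst₂ (Rep d (c ∷ b ∷ ys)) (+-swap (suc t) (suc s) l) (eq (a ℤ.* x) (a′ ℤ.* y) v) (u′ ∷ u ∷ rep-↭ σ r)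
  where
  eq : ∀ r s v → s ℤ.+ (r ℤ.+ v) ≡ r ℤ.+ (s ℤ.+ v)
  eq = solve-∀
rep-↭ (Perm.trans σ τ) r = rep-↭ τ (rep-↭ σ r)

reaches-↭ : ∀ {d bs cs l} → bs ↭ cs → Reaches d bs l → Reaches d cs l
reaches-↭ σ (v , r , h) = v , rep-↭ σ r , h

reaches-skip : ∀ {d b bs l} → Reaches d bs l → Reaches d (b ∷ bs) l
reaches-skip (v , r , h) = v , skip r , h

-- A weight `c` on the merged block is distributed as `c` on `x` and `c a` on `y`. The merged block
-- has `(s + 1) + (t + 1)` terms, hence first component `suc (s + t)`.
rep-merge : ∀ {d a s t x y bs l v} → Unit d a →
            Rep d ((suc (s + t) , x ℤ.+ a ℤ.* y) ∷ bs) l v → Rep d ((s , x) ∷ (t , y) ∷ bs) l v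
rep-merge u (skip r) = skip (skip r)
rep-merge {d} {a} {s} {t} {x} {y} {bs} u (_∷_ {c} {l = l} {v} w r) =
  subst₂ (Rep d ((s , x) ∷ (t , y) ∷ bs)) eqˡ (eq a c x y v) (w ∷ unit-product w u ∷ r)
  where
  eq : ∀ a c x y v → c ℤ.* x ℤ.+ (c ℤ.* a ℤ.* y ℤ.+ v) ≡ c ℤ.* (x ℤ.+ a ℤ.* y) ℤ.+ v
  eq = solve-∀
  eqˡ : suc s + (suc t + l) ≡ suc (suc (s + t)) + l
  eqˡ = cong suc (trans (ℕₚ.+-suc s (t + l)) (cong suc (sym (ℕₚ.+-assoc s t l))))

reaches-merge : ∀ {d a s t x y bs l} → Unit d a →
                Reaches d ((suc (s + t) , x ℤ.+ a ℤ.* y) ∷ bs) l → Reaches d ((s , x) ∷ (t , y) ∷ bs) l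
reaches-merge u (v , r , h) = v , rep-merge u r , h

scale : ℕ → Block → Block
scale p (s , x) = s , + p ℤ.* x

rep-scale-∷ : ∀ {p d a s x bs l v} → ∃[ c ] Unit (+ p ℤ.* d) c × d ∣ᶻ c ℤ.- a →
              ∃[ w ] Rep (+ p ℤ.* d) (map (scale p) bs) l (+ p ℤ.* w) × d ∣ᶻ w ℤ.- v →
              ∃[ w ] Rep (+ p ℤ.* d) (map (scale p) ((s , x) ∷ bs)) (suc s + l) (+ p ℤ.* w) × d ∣ᶻ w ℤ.- (a ℤ.* x ℤ.+ v)
rep-scale-∷ {p} {d} {a} {s} {x} {bs} {l} {v} (c , u , h) (w , r , g) =
  c ℤ.* x ℤ.+ w ,
  subst (Rep _ _ (suc s + l)) (eq c (+ p) x w) (u ∷ r) ,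
  ∣-step a c x w v h g
  where
  eq : ∀ c p x w → c ℤ.* (p ℤ.* x) ℤ.+ p ℤ.* w ≡ p ℤ.* (c ℤ.* x ℤ.+ w)
  eq = solve-∀

-- A unit modulo `d` may be divisible by `p`, so every weight used is first corrected by
-- `lift-unit`. This moves the sum by a multiple of `d`, harmless once the values are multiplied by
-- `p`.
rep-scale : ∀ {p d bs l v} → Prime p → Rep d bs l v →
            ∃[ w ] Rep (+ p ℤ.* d) (map (scale p) bs) l (+ p ℤ.* w) × d ∣ᶻ w ℤ.- v
rep-scale {p} {d} pp [] = 0ℤ , subst (Rep (+ p ℤ.* d) [] 0) (sym (ℤₚ.*-zeroʳ (+ p))) [] , divides 0ℤ refl
rep-scale {p} pp (skip r) = let w , r′ , h = rep-scale {p} pp r in w , skip r′ , h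
rep-scale {p} pp (u ∷ r) = rep-scale-∷ {p} (lift-unit {p} pp u) (rep-scale {p} pp r)

reaches-scale : ∀ {p d bs l} → Prime p → Reaches d bs l → Reaches (+ p ℤ.* d) (map (scale p) bs) l
reaches-scale {p} pp (v , r , d∣v) =
  let w , r′ , h = rep-scale {p} pp r
  in  + p ℤ.* w , r′ , ℤd.*-monoʳ-∣ (+ p) (∣-of-difference w v h d∣v)

comb⇒rep : ∀ {d v} bs cs → Comb d (map value bs) v → Rep d (bs ++ cs) (totalSize bs) v
comb⇒rep []       []       []      = []
comb⇒rep []       (c ∷ cs) []      = skip (comb⇒rep [] cs [])
comb⇒rep (b ∷ bs) cs       (u ∷ c) = u ∷ comb⇒rep bs cs c

solvable⇒reaches : ∀ {d l as} bs cs → as ↭ bs ++ cs → totalSize bs ≡ l →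
                   Solvable d (map value bs) → Reaches d as l
solvable⇒reaches bs cs σ refl (v , c , h) = v , rep-↭ (↭-sym σ) (comb⇒rep bs cs c) , h

filter-split : ∀ {A : Set} {P : A → Set} (P? : Decidable P) xs →
               xs ↭ filter P? xs ++ filter (λ x → ¬? (P? x)) xs
filter-split P? [] = ↭-refl
filter-split P? (x ∷ xs) with P? x
... | yes _ = ↭-prep x (filter-split P? xs)
... | no  _ = ↭-trans (↭-prep x (filter-split P? xs)) (↭-sym (Permₚ.shift x (filter P? xs) _))

-- Counting blocks nonzero modulo a prime, and removing a prime with few of them.

Nonzero : ℕ → Block → Set
Nonzero p b = ¬ (+ p ∣ᶻ value b)

nonzero? : ∀ p → Decidable (Nonzero p)
nonzero? p b = ¬? (+ p ∣ᶻ? value b)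

zero? : ∀ p → Decidable (λ b → ¬ Nonzero p b)
zero? p b = ¬? (nonzero? p b)

count : ℕ → List Block → ℕ
count p bs = length (filter (nonzero? p) bs)

count-↭ : ∀ {p bs cs} → bs ↭ cs → count p bs ≡ count p cs
count-↭ {p} σ = Permₚ.↭-length (Permₚ.filter-↭ (nonzero? p) σ)

count-++ : ∀ {p} bs {cs} → count p (bs ++ cs) ≡ count p bs + count p cs
count-++ {p} bs {cs} = trans (cong length (Listₚ.filter-++ (nonzero? p) bs cs)) (Listₚ.length-++ (filter (nonzero? p) bs))

totalSize-++ : ∀ bs {cs} → totalSize (bs ++ cs) ≡ totalSize bs + totalSize cs
totalSize-++ bs {cs} = trans (cong sum (Listₚ.map-++ size bs cs)) (sum-++ (map size bs) (map size cs))

excess-++ : ∀ bs {cs} → excess (bs ++ cs) ≡ excess bs + excess cs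
excess-++ bs {cs} = trans (cong sum (Listₚ.map-++ proj₁ bs cs)) (sum-++ (map proj₁ bs) (map proj₁ cs))

totalSize-↭ : ∀ {bs cs} → bs ↭ cs → totalSize bs ≡ totalSize cs
totalSize-↭ σ = sum-↭ (Permₚ.map⁺ size σ)

excess-↭ : ∀ {bs cs} → bs ↭ cs → excess bs ≡ excess cs
excess-↭ σ = sum-↭ (Permₚ.map⁺ proj₁ σ)

unscale : ∀ {p bs} → All (λ b → ¬ Nonzero p b) bs →
          ∃[ cs ] bs ≡ map (scale p) cs
unscale [] = [] , refl
unscale {p} {(s , x) ∷ bs} (h ∷ hs) with decidable-stable (+ p ∣ᶻ? x) h | unscale hs
... | divides q refl | cs , refl = (s , q) ∷ cs , cong (λ y → (s , y) ∷ map (scale p) cs) (ℤₚ.*-comm q (+ p))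

excess-scale : ∀ {p} bs → excess (map (scale p) bs) ≡ excess bs
excess-scale []             = refl
excess-scale {p} ((s , _) ∷ bs) = cong (λ e → s + e) (excess-scale {p} bs)

-- These are the cases that `compress` handles by dropping or merging. Outside them there are at
-- least two odd values for `p = 2`, and at least three nonzero values for odd `p`.
Few : List Block → ℕ → Set
Few bs p = count p bs ≤ 1 ⊎ (p ≢ 2 × count p bs ≤ 2)

few? : ∀ bs → Decidable (Few bs)
few? bs p = (count p bs ℕₚ.≤? 1) ⊎-dec (¬? (p ℕₚ.≟ 2) ×-dec (count p bs ℕₚ.≤? 2))

-- An odd prime is charged 3 units of total size: protecting it sets aside at
-- most three single blocks, and merging for it raises by 2 twice the excess,
-- which bounds the total size of the blocks that are not single.
cost : ℕ → ℕ
cost 2 = 0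
cost _ = 3

cost-odd : ∀ {p} → p ≢ 2 → cost p ≡ 3
cost-odd {0}                 _   = refl
cost-odd {1}                 _   = refl
cost-odd {2}                 2≢2 = contradiction refl 2≢2
cost-odd {suc (suc (suc _))} _   = refl

-- The target length `l` is the same on both sides of `reaches`. The block lost is balanced by the
-- prime lost in the inequality `l + length ps ≤ length as` of `blocks-reach`, and the growth of the
-- excess by the cost of `p`.
record Compression (p : ℕ) (ps : List ℕ) (bs : List Block) : Set where
  field
    blocks   : List Block
    length≤  : length bs ≤ suc (length blocks)
    excess≤  : 2 * excess blocks ≤ 2 * excess bs + cost p
    reaches  : ∀ {l} → Reaches (+ product ps) blocks l → Reaches (+ product (p ∷ ps)) bs l

compression-↭ : ∀ {p ps bs cs} → bs ↭ cs → Compression p ps cs → Compression p ps bs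
compression-↭ {p} σ c = record
  { blocks  = blocks
  ; length≤ = subst (_≤ suc (length blocks)) (sym (Permₚ.↭-length σ)) length≤
  ; excess≤ = subst (λ e → 2 * excess blocks ≤ 2 * e + cost p) (sym (excess-↭ σ)) excess≤
  ; reaches = λ r → reaches-↭ (↭-sym σ) (reaches r)
  }
  where open Compression c

reaches-scale-product : ∀ {p ps bs l} → Prime p → Reaches (+ product ps) bs l →
                        Reaches (+ product (p ∷ ps)) (map (scale p) bs) l
reaches-scale-product {p} {ps} {bs} {l} pp r =
  subst (λ d → Reaches d (map (scale p) bs) l) (sym (ℤₚ.pos-* p (product ps))) (reaches-scale pp r)

compress-none : ∀ {p ps} → Prime p → ∀ bs → Compression p ps (map (scale p) bs)
compress-none {p} {ps} pp bs = record
  { blocks  = bs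
  ; length≤ = ℕₚ.≤-trans (ℕₚ.≤-reflexive (Listₚ.length-map (scale p) bs)) (ℕₚ.n≤1+n (length bs))
  ; excess≤ = ℕₚ.≤-trans (ℕₚ.≤-reflexive (cong (2 *_) (sym (excess-scale {p} bs)))) (ℕₚ.m≤m+n _ (cost p))
  ; reaches = reaches-scale-product {p} {ps} pp
  }

compress-one : ∀ {p ps} → Prime p → ∀ b bs → Compression p ps (b ∷ map (scale p) bs)
compress-one {p} {ps} pp b bs = record
  { blocks  = bs
  ; length≤ = s≤s (ℕₚ.≤-reflexive (Listₚ.length-map (scale p) bs))
  ; excess≤ = ℕₚ.≤-trans (ℕₚ.*-monoʳ-≤ 2 (ℕₚ.≤-trans (ℕₚ.≤-reflexive (sym (excess-scale {p} bs))) (ℕₚ.m≤n+m _ (proj₁ b))))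
                         (ℕₚ.m≤m+n _ (cost p))
  ; reaches = λ r → reaches-skip (reaches-scale-product {p} {ps} pp r)
  }

-- The weight making `x + a y` divisible by `p` has to be a unit modulo the full product for
-- `reaches-merge`, so it is lifted; the lift changes it by a multiple of `p` and divisibility
-- survives.
compress-two : ∀ {p ps} → Prime p → p ≢ 2 → All Prime ps → ∀ b c bs → Nonzero p b → Nonzero p c →
               Compression p ps (b ∷ c ∷ map (scale p) bs)
compress-two {p} {ps} pp p≢2 pps (s , x) (t , y) bs ∤x ∤y = record
  { blocks  = (suc (s + t) , q) ∷ bs
  ; length≤ = s≤s (s≤s (ℕₚ.≤-reflexive (Listₚ.length-map (scale p) bs)))
  ; excess≤ = excess≤
  ; reaches = λ {l} r → reaches-merge (proj₁ (proj₂ lifted))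
                (subst (λ z → Reaches (+ product (p ∷ ps)) ((suc (s + t) , z) ∷ map (scale p) bs) l) q-eq
                  (reaches-scale-product {p} {ps} {bs = (suc (s + t) , q) ∷ bs} pp r))
  }
  where
  lifted : ∃[ a ] Unit (+ product (p ∷ ps)) a × + p ∣ᶻ x ℤ.+ a ℤ.* y
  lifted =
    let a , ua , h  = cancelling-weight {w = x} {y} pp ∤x ∤y
        b , ub , h′ = lift-units p ps pps ua
    in  b , ub , subst (+ p ∣ᶻ_) (eq x a b y) (ℤd.∣m∣n⇒∣m+n h (ℤd.∣m⇒∣m*n y h′))
    where
    eq : ∀ x a b y → x ℤ.+ a ℤ.* y ℤ.+ (b ℤ.- a) ℤ.* y ≡ x ℤ.+ b ℤ.* y
    eq = solve-∀
  q : ℤ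
  q = ℤd._∣_.quotient (proj₂ (proj₂ lifted))
  q-eq : + p ℤ.* q ≡ x ℤ.+ proj₁ lifted ℤ.* y
  q-eq = trans (ℤₚ.*-comm (+ p) q) (sym (ℤd._∣_.equality (proj₂ (proj₂ lifted))))
  excess≤ : 2 * (suc (s + t) + excess bs) ≤ 2 * (s + (t + excess (map (scale p) bs))) + cost p
  excess≤ = begin
    2 * (suc (s + t) + excess bs)                      ≡⟨ cong (λ e → 2 * suc e) (ℕₚ.+-assoc s t (excess bs)) ⟩
    2 * suc (s + (t + excess bs))                      ≡⟨ ℕₚ.*-suc 2 (s + (t + excess bs)) ⟩
    2 + 2 * (s + (t + excess bs))                      ≡⟨ ℕₚ.+-comm 2 _ ⟩
    2 * (s + (t + excess bs)) + 2                      ≡⟨ cong (λ e → 2 * (s + (t + e)) + 2) (sym (excess-scale {p} bs)) ⟩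
    -- One merge adds 2 to twice the excess, within the charge of 3 for an odd prime.
    2 * (s + (t + excess (map (scale p) bs))) + 2      ≤⟨ ℕₚ.+-monoʳ-≤ _ (ℕₚ.≤-trans (ℕₚ.n≤1+n 2) (ℕₚ.≤-reflexive (sym (cost-odd p≢2)))) ⟩
    2 * (s + (t + excess (map (scale p) bs))) + cost p ∎
    where open ℕₚ.≤-Reasoning

compress : ∀ {p ps bs} → Prime p → All Prime ps → Few bs p → Compression p ps bs
compress {p} {ps} {bs} pp pps few
  with filter (nonzero? p) bs | filter (zero? p) bs | filter-split (nonzero? p) bs
     | Allₚ.all-filter (nonzero? p) bs | unscale (Allₚ.all-filter (zero? p) bs) | few
... | []             | _ | σ | _           | cs , refl | _ = compression-↭ σ (compress-none pp cs)
... | b ∷ []         | _ | σ | _           | cs , refl | _ = compression-↭ σ (compress-one pp b cs)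
... | b ∷ c ∷ []     | _ | σ | nb ∷ nc ∷ _ | cs , refl | inj₂ (p≢2 , _) =
      compression-↭ σ (compress-two pp p≢2 pps b c cs nb nc)
... | _ ∷ _ ∷ _      | _ | _ | _           | _         | inj₁ (s≤s ())
... | _ ∷ _ ∷ _ ∷ _  | _ | _ | _           | _         | inj₂ (_ , s≤s (s≤s ()))

-- Selections of even sum

length≤totalSize : ∀ bs → length bs ≤ totalSize bs
length≤totalSize []             = z≤n
length≤totalSize ((s , _) ∷ bs) = s≤s (ℕₚ.≤-trans (length≤totalSize bs) (ℕₚ.m≤n+m (totalSize bs) s))

Single : Block → Set
Single b = proj₁ b ≡ 0

single? : Decidable Single
single? b = proj₁ b ℕₚ.≟ 0

totalSize-singles : ∀ {bs} → All Single bs → totalSize bs ≡ length bs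
totalSize-singles []          = refl
totalSize-singles (refl ∷ hs) = cong suc (totalSize-singles hs)

-- A block of `s + 1` terms with `s` positive satisfies `s + 1 ≤ 2 s`.
totalSize-bulky : ∀ {bs} → All (λ b → ¬ Single b) bs → totalSize bs ≤ 2 * excess bs
totalSize-bulky [] = z≤n
totalSize-bulky {(zero , _) ∷ _} (h ∷ _) = contradiction refl h
totalSize-bulky {(suc s , _) ∷ bs} (_ ∷ hs) = begin
  suc (suc s) + totalSize bs          ≤⟨ ℕₚ.+-mono-≤ {suc (suc s)} {2 * suc s} size≤ (totalSize-bulky hs) ⟩
  2 * suc s + 2 * excess bs           ≡⟨ sym (ℕₚ.*-distribˡ-+ 2 (suc s) (excess bs)) ⟩
  2 * (suc s + excess bs)             ∎
  where
  open ℕₚ.≤-Reasoning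
  size≤ : suc (suc s) ≤ 2 * suc s
  size≤ = s≤s (ℕₚ.≤-trans (s≤s (ℕₚ.m≤m+n s 0)) (ℕₚ.m≤n+m (suc (s + 0)) s))

-- Setting blocks aside for the odd primes.

count-all : ∀ {p bs} → All (Nonzero p) bs → count p bs ≡ length bs
count-all {p} hs = cong length (Listₚ.filter-all (nonzero? p) hs)

count-zero : ∀ {p bs} → All (λ b → ¬ Nonzero p b) bs → count p bs ≡ 0
count-zero {p} hs = cong length (Listₚ.filter-none (nonzero? p) hs)

count≤length : ∀ {p} bs → count p bs ≤ length bs
count≤length {p} bs = Listₚ.length-filter (nonzero? p) bs

-- The spare blocks are single so that the total size can be tuned one unit at a time. Two nonzero
-- values per odd prime suffice for `solvable-odd`; the third is insurance, since correcting the
-- parity may drop one core block. The form of `core≤` matches the bound in `dense-reaches`, which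
-- then leaves two places free.
record Protection (ps : List ℕ) (as : List Block) : Set where
  field
    core spare : List Block
    perm       : as ↭ core ++ spare
    singles    : All Single spare
    core≤      : totalSize core ≤ 2 * excess as + sum (map cost ps)
    protected  : All (λ p → p ≢ 2 → 3 ≤ count p core) ps

¬few⇒3≤count : ∀ {p as} → p ≢ 2 → ¬ Few as p → 3 ≤ count p as
¬few⇒3≤count p≢2 ¬few = ℕₚ.≰⇒> λ c≤2 → ¬few (inj₂ (p≢2 , c≤2))

split-at : ∀ {A : Set} n (xs : List A) ys → xs ++ ys ↭ take n xs ++ (drop n xs ++ ys)
split-at n xs ys = ↭-reflexive
  (trans (cong (_++ ys) (sym (Listₚ.take++drop≡id n xs))) (Listₚ.++-assoc (take n xs) (drop n xs) ys))

⊓-bound : ∀ n x y → n ≤ x + y → n ≤ (n ℕ.⊓ x) + y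
⊓-bound n x y h with ℕₚ.≤-total n x
... | inj₁ n≤x = subst (λ m → n ≤ m + y) (sym (ℕₚ.m≤n⇒m⊓n≡m n≤x)) (ℕₚ.m≤m+n n y)
... | inj₂ x≤n = subst (λ m → n ≤ m + y) (sym (ℕₚ.m≥n⇒m⊓n≡n x≤n)) h

protect-start : ∀ as → Protection [] as
protect-start as = record
  { core      = bulky
  ; spare     = filter single? as
  ; perm      = σ
  ; singles   = Allₚ.all-filter single? as
  ; core≤     = begin
      totalSize bulky         ≤⟨ totalSize-bulky (Allₚ.all-filter (¬? ∘ single?) as) ⟩
      2 * excess bulky        ≤⟨ ℕₚ.*-monoʳ-≤ 2 (ℕₚ.m≤m+n (excess bulky) (excess (filter single? as))) ⟩
      2 * (excess bulky + excess (filter single? as)) ≡⟨ cong (2 *_) (sym (trans (excess-↭ σ) (excess-++ bulky))) ⟩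
      2 * excess as           ≡⟨ sym (ℕₚ.+-identityʳ _) ⟩
      2 * excess as + 0       ∎
  ; protected = []
  }
  where
  open ℕₚ.≤-Reasoning
  bulky = filter (¬? ∘ single?) as
  σ : as ↭ bulky ++ filter single? as
  σ = ↭-trans (filter-split single? as) (Permₚ.++-comm (filter single? as) bulky)

protect-skip : ∀ {ps as} → Protection ps as → Protection (2 ∷ ps) as
protect-skip π = record
  { core = core ; spare = spare ; perm = perm ; singles = singles ; core≤ = core≤
  ; protected = (λ 2≢2 → contradiction refl 2≢2) ∷ protected }
  where open Protection π

protect-step : ∀ {p ps as} → p ≢ 2 → 3 ≤ count p as → Protection ps as → Protection (p ∷ ps) as
protect-step {p} {ps} {as} p≢2 3≤ π = record
  { core      = moved ++ core
  ; spare     = left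
  ; perm      = ↭-trans perm (↭-trans (Permₚ.++⁺ˡ core τ)
                  (↭-trans (Permₚ.shifts core moved) (↭-reflexive (sym (Listₚ.++-assoc moved core left)))))
  ; singles   = Allₚ.++⁻ʳ moved singles′
  ; core≤     = core≤′
  ; protected = (λ _ → 3≤core) ∷ All.map (λ h q≢2 → ℕₚ.≤-trans (h q≢2) (grow _)) protected
  }
  where
  open Protection π
  F G moved left : List Block
  F     = filter (nonzero? p) spare
  G     = filter (zero? p) spare
  moved = take 3 F
  left  = drop 3 F ++ G
  τ : spare ↭ moved ++ left
  τ = ↭-trans (filter-split (nonzero? p) spare) (split-at 3 F G)
  singles′ : All Single (moved ++ left)
  singles′ = Permₚ.All-resp-↭ τ singles
  grow : ∀ q → count q core ≤ count q (moved ++ core)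
  grow q = ℕₚ.≤-trans (ℕₚ.m≤n+m _ (count q moved)) (ℕₚ.≤-reflexive (sym (count-++ moved)))
  3≤core : 3 ≤ count p (moved ++ core)
  3≤core = begin
    -- If fewer than three spare blocks are nonzero modulo `p`, all of them are moved, and the core
    -- then holds every nonzero block.
    3                                   ≤⟨ ⊓-bound 3 (length F) (count p core) (ℕₚ.≤-trans 3≤ (ℕₚ.≤-reflexive
                                             (trans (count-↭ perm) (trans (count-++ core) (ℕₚ.+-comm (count p core) _))))) ⟩
    3 ℕ.⊓ length F + count p core       ≡⟨ cong (_+ count p core) (sym (Listₚ.length-take 3 F)) ⟩
    length moved + count p core         ≡⟨ cong (_+ count p core) (sym (count-all (Allₚ.take⁺ 3 (Allₚ.all-filter (nonzero? p) spare)))) ⟩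
    count p moved + count p core        ≡⟨ sym (count-++ moved) ⟩
    count p (moved ++ core)             ∎
    where open ℕₚ.≤-Reasoning
  core≤′ : totalSize (moved ++ core) ≤ 2 * excess as + (cost p + sum (map cost ps))
  core≤′ = begin
    totalSize (moved ++ core)           ≡⟨ totalSize-++ moved ⟩
    totalSize moved + totalSize core    ≡⟨ cong (_+ totalSize core) (totalSize-singles (Allₚ.++⁻ˡ moved singles′)) ⟩
    length moved + totalSize core       ≡⟨ cong (_+ totalSize core) (Listₚ.length-take 3 F) ⟩
    3 ℕ.⊓ length F + totalSize core     ≤⟨ ℕₚ.+-mono-≤ (ℕₚ.m⊓n≤m 3 (length F)) core≤ ⟩
    3 + (2 * excess as + sum (map cost ps))      ≡⟨ cong (_+ _) (sym (cost-odd p≢2)) ⟩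
    cost p + (2 * excess as + sum (map cost ps)) ≡⟨ +-swap (cost p) (2 * excess as) _ ⟩
    2 * excess as + (cost p + sum (map cost ps)) ∎
    where open ℕₚ.≤-Reasoning

protect : ∀ {as ps} → All (λ p → ¬ Few as p) ps → Protection ps as
protect {as} []                 = protect-start as
protect {as} {p ∷ _} (¬few ∷ ¬fews) with p ℕₚ.≟ 2
... | yes refl = protect-skip (protect ¬fews)
... | no  p≢2  = protect-step p≢2 (¬few⇒3≤count {p} {as} p≢2 ¬few) (protect ¬fews)

-- Adjusting the parity of a selection.

sumᶻ-++ : ∀ xs ys → sumᶻ (xs ++ ys) ≡ sumᶻ xs ℤ.+ sumᶻ ys
sumᶻ-++ []       ys = sym (ℤₚ.+-identityˡ (sumᶻ ys))
sumᶻ-++ (x ∷ xs) ys = trans (cong (λ v → x ℤ.+ v) (sumᶻ-++ xs ys)) (sym (ℤₚ.+-assoc x (sumᶻ xs) (sumᶻ ys)))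

Σᵇ : (Block → ℤ) → List Block → ℤ
Σᵇ f bs = sumᶻ (map f bs)

Σᵇ-++ : ∀ f bs cs → Σᵇ f (bs ++ cs) ≡ Σᵇ f bs ℤ.+ Σᵇ f cs
Σᵇ-++ f bs cs = trans (cong sumᶻ (Listₚ.map-++ f bs cs)) (sumᶻ-++ (map f bs) (map f cs))

∣Σᵇ : ∀ {d f bs} → All (λ b → d ∣ᶻ f b) bs → d ∣ᶻ Σᵇ f bs
∣Σᵇ []       = divides 0ℤ refl
∣Σᵇ (h ∷ hs) = ℤd.∣m∣n⇒∣m+n h (∣Σᵇ hs)

-- The first block with odd `f` decides: if the blocks after it have even sum it is dropped, and
-- otherwise its oddness already corrects theirs.
drop-odd : ∀ f bs → ∃₂ λ cs ds → bs ↭ cs ++ ds × length ds ≤ 1 × + 2 ∣ᶻ Σᵇ f cs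
drop-odd f [] = [] , [] , ↭-refl , z≤n , divides 0ℤ refl
drop-odd f (b ∷ bs) with + 2 ∣ᶻ? f b | + 2 ∣ᶻ? Σᵇ f bs
... | no ∤b   | yes ∣bs = bs , b ∷ [] , Permₚ.∷↭∷ʳ b bs , s≤s z≤n , ∣bs
... | no ∤b   | no ∤bs  = b ∷ bs , [] , ↭-reflexive (sym (Listₚ.++-identityʳ (b ∷ bs))) , z≤n , odd+odd {f b} {Σᵇ f bs} ∤b ∤bs
... | yes ∣b  | _       = let cs , ds , σ , h , ∣cs = drop-odd f bs in
  b ∷ cs , ds , ↭-prep b σ , h , ℤd.∣m∣n⇒∣m+n ∣b ∣cs

-- The successor in `counts` allows for one dropped core block. With `even` and `odd` the selection
-- is locally solvable at 2, the odd value being the term to shift when 2 is a repeated factor.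
record EvenSelection (l : ℕ) (core as : List Block) : Set where
  field
    chosen rest : List Block
    perm        : as ↭ chosen ++ rest
    size≡       : totalSize chosen ≡ l
    counts      : ∀ p → count p core ≤ suc (count p chosen)
    even        : + 2 ∣ᶻ Σᵇ value chosen
    odd         : 1 ≤ count 2 chosen

fill : ∀ {l} core spare → All Single spare → totalSize core ≤ l → l ≤ totalSize core + length spare →
       totalSize (core ++ take (l ℕ.∸ totalSize core) spare) ≡ l
fill {l} core spare singles core≤l l≤ = begin
  totalSize (core ++ take j spare)         ≡⟨ totalSize-++ core ⟩
  totalSize core + totalSize (take j spare) ≡⟨ cong (λ n → totalSize core + n) (totalSize-singles (Allₚ.take⁺ j singles)) ⟩
  totalSize core + length (take j spare)   ≡⟨ cong (λ n → totalSize core + n) (Listₚ.length-take j spare) ⟩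
  totalSize core + j ℕ.⊓ length spare      ≡⟨ cong (λ n → totalSize core + n) (ℕₚ.m≤n⇒m⊓n≡m (ℕₚ.m≤n+o⇒m∸n≤o l (totalSize core) l≤)) ⟩
  totalSize core + j                       ≡⟨ ℕₚ.m+[n∸m]≡n core≤l ⟩
  l                                        ∎
  where
  open ≡-Reasoning
  j = l ℕ.∸ totalSize core

interchange-↭ : ∀ {A : Set} (as bs cs ds : List A) → (as ++ bs) ++ (cs ++ ds) ↭ (as ++ cs) ++ (bs ++ ds)
interchange-↭ as bs cs ds = begin
  (as ++ bs) ++ (cs ++ ds)  ≡⟨ Listₚ.++-assoc as bs (cs ++ ds) ⟩
  as ++ (bs ++ (cs ++ ds))  ↭⟨ Permₚ.++⁺ˡ as (Permₚ.shifts bs cs) ⟩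
  as ++ (cs ++ (bs ++ ds))  ≡⟨ sym (Listₚ.++-assoc as cs (bs ++ ds)) ⟩
  (as ++ cs) ++ (bs ++ ds)  ∎
  where open Perm.PermutationReasoning

-- f is a proxy for the value with the same parity of sums over selections of total size l.
select-uniform : ∀ {l core spare} (f : Block → ℤ) →
  (∀ bs → totalSize bs ≡ l → + 2 ∣ᶻ Σᵇ f bs → + 2 ∣ᶻ Σᵇ value bs) →
  All Single spare → All (λ b → + 2 ∣ᶻ f b) spare →
  totalSize core ℕ.< l → l ℕ.< length core + length spare →
  2 ≤ count 2 core ⊎ (∃₂ λ o bs → spare ≡ o ∷ bs × Nonzero 2 o) →
  EvenSelection l core (core ++ spare)
select-uniform {l} {core} {spare} f proxy singles evens core<l l< odds with drop-odd f core
... | kept , dropped , σ , dropped≤1 , ∣kept = record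
  { chosen = chosen
  ; rest   = dropped ++ drop j spare
  ; perm   = perm
  ; size≡  = size≡
  ; counts = λ p → ℕₚ.≤-trans (kept-count p) (s≤s (grow p))
  ; even   = proxy chosen size≡ (subst (+ 2 ∣ᶻ_) (sym (Σᵇ-++ f kept (take j spare)))
               (ℤd.∣m∣n⇒∣m+n ∣kept (∣Σᵇ (Allₚ.take⁺ j evens))))
  ; odd    = odd odds
  }
  where
  j = l ℕ.∸ totalSize kept
  chosen = kept ++ take j spare
  kept≤ : totalSize kept ≤ totalSize core
  kept≤ = ℕₚ.≤-trans (ℕₚ.m≤m+n (totalSize kept) (totalSize dropped))
            (ℕₚ.≤-reflexive (sym (trans (totalSize-↭ σ) (totalSize-++ kept))))
  kept<l : totalSize kept ℕ.< l
  kept<l = ℕₚ.≤-<-trans kept≤ core<l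
  core-length : length core ≤ suc (length kept)
  core-length = begin
    length core                   ≡⟨ Permₚ.↭-length σ ⟩
    length (kept ++ dropped)      ≡⟨ Listₚ.length-++ kept ⟩
    length kept + length dropped  ≤⟨ ℕₚ.+-monoʳ-≤ (length kept) dropped≤1 ⟩
    length kept + 1               ≡⟨ ℕₚ.+-comm (length kept) 1 ⟩
    suc (length kept)             ∎
    where open ℕₚ.≤-Reasoning
  l≤ : l ≤ totalSize kept + length spare
  -- The strictness of `l<` pays for the block that may have been dropped.
  l≤ = ℕ.s≤s⁻¹ (begin
    suc l                                 ≤⟨ l< ⟩
    length core + length spare            ≤⟨ ℕₚ.+-monoˡ-≤ (length spare) core-length ⟩
    suc (length kept + length spare)      ≤⟨ s≤s (ℕₚ.+-monoˡ-≤ (length spare) (length≤totalSize kept)) ⟩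
    suc (totalSize kept + length spare)   ∎)
    where open ℕₚ.≤-Reasoning
  size≡ : totalSize chosen ≡ l
  size≡ = fill kept spare singles (ℕₚ.<⇒≤ kept<l) l≤
  perm : core ++ spare ↭ chosen ++ (dropped ++ drop j spare)
  perm = begin
    core ++ spare                                       ↭⟨ Permₚ.++⁺ʳ spare σ ⟩
    (kept ++ dropped) ++ spare                          ≡⟨ cong ((kept ++ dropped) ++_) (sym (Listₚ.take++drop≡id j spare)) ⟩
    (kept ++ dropped) ++ (take j spare ++ drop j spare) ↭⟨ interchange-↭ kept dropped (take j spare) (drop j spare) ⟩
    chosen ++ (dropped ++ drop j spare)                 ∎
    where open Perm.PermutationReasoning
  kept-count : ∀ p → count p core ≤ suc (count p kept)
  kept-count p = begin
    count p core                    ≡⟨ trans (count-↭ σ) (count-++ kept) ⟩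
    count p kept + count p dropped  ≤⟨ ℕₚ.+-monoʳ-≤ (count p kept) (ℕₚ.≤-trans (count≤length dropped) dropped≤1) ⟩
    count p kept + 1                ≡⟨ ℕₚ.+-comm (count p kept) 1 ⟩
    suc (count p kept)              ∎
    where open ℕₚ.≤-Reasoning
  grow : ∀ p → count p kept ≤ count p chosen
  grow p = ℕₚ.≤-trans (ℕₚ.m≤m+n _ _) (ℕₚ.≤-reflexive (sym (count-++ kept)))
  1≤j : 1 ≤ j
  1≤j = ℕₚ.m<n⇒0<n∸m kept<l
  -- Either one of two odd core blocks survives the drop, or the spare list starts with an odd
  -- block, which is taken because `j` is positive.
  odd : 2 ≤ count 2 core ⊎ (∃₂ λ o bs → spare ≡ o ∷ bs × Nonzero 2 o) → 1 ≤ count 2 chosen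
  odd (inj₁ 2≤) = ℕₚ.≤-trans (ℕ.s≤s⁻¹ (ℕₚ.≤-trans 2≤ (kept-count 2))) (grow 2)
  odd (inj₂ (o , bs , refl , ∤o)) = begin
    1                                     ≤⟨ 1≤count-take 1≤j ⟩
    count 2 (take j spare)                ≤⟨ ℕₚ.m≤n+m _ (count 2 kept) ⟩
    count 2 kept + count 2 (take j spare) ≡⟨ sym (count-++ kept) ⟩
    count 2 chosen                        ∎
    where
    open ℕₚ.≤-Reasoning
    1≤count-take : ∀ {i} → 1 ≤ i → 1 ≤ count 2 (take i (o ∷ bs))
    1≤count-take {suc i} _ = ℕₚ.≤-trans (s≤s z≤n)
      (ℕₚ.≤-reflexive (sym (cong length (Listₚ.filter-accept (nonzero? 2) {o} {take i bs} ∤o))))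

-- The odd single o and the even single e are exchanged to correct the parity.
select-mixed : ∀ {l core o e spare} → All Single (o ∷ e ∷ spare) → Nonzero 2 o → ¬ Nonzero 2 e →
  1 ≤ count 2 core → totalSize core ℕ.< l → l ≤ suc (totalSize core + length spare) →
  EvenSelection l core (core ++ o ∷ e ∷ spare)
select-mixed {l} {core} {o@(.0 , x)} {e@(.0 , y)} {spare} (refl ∷ refl ∷ singles) ∤o ¬∤e 1≤ core<l l≤ =
  select (+ 2 ∣ᶻ? Σᵇ value (with-single e))
  where
  -- One place is reserved for the exchanged single block.
  j = l ℕ.∸ suc (totalSize core)
  with-single : Block → List Block
  with-single b = b ∷ core ++ take j spare
  ∣e : + 2 ∣ᶻ value e
  ∣e = decidable-stable (+ 2 ∣ᶻ? y) ¬∤e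
  grow : ∀ b p → count p core ≤ count p (with-single b)
  grow b p = begin
    count p core                                         ≤⟨ ℕₚ.m≤m+n _ _ ⟩
    count p core + count p (take j spare)                ≡⟨ sym (count-++ core) ⟩
    count p (core ++ take j spare)                       ≤⟨ ℕₚ.m≤n+m _ (count p (b ∷ [])) ⟩
    count p (b ∷ []) + count p (core ++ take j spare)    ≡⟨ sym (count-++ {p} (b ∷ []) {core ++ take j spare}) ⟩
    count p (with-single b)                              ∎
    where open ℕₚ.≤-Reasoning
  σ : ∀ b c → core ++ b ∷ c ∷ spare ↭ with-single b ++ (c ∷ drop j spare)
  σ b c = begin
    core ++ b ∷ c ∷ spare                             ↭⟨ Permₚ.shift b core (c ∷ spare) ⟩
    b ∷ core ++ c ∷ spare                             ≡⟨ cong (λ bs → b ∷ core ++ c ∷ bs) (sym (Listₚ.take++drop≡id j spare)) ⟩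
    b ∷ core ++ c ∷ take j spare ++ drop j spare      ↭⟨ ↭-prep b (Permₚ.++⁺ˡ core (↭-sym (Permₚ.shift c (take j spare) (drop j spare)))) ⟩
    b ∷ core ++ take j spare ++ c ∷ drop j spare      ≡⟨ cong (b ∷_) (sym (Listₚ.++-assoc core (take j spare) (c ∷ drop j spare))) ⟩
    with-single b ++ (c ∷ drop j spare)               ∎
    where open Perm.PermutationReasoning
  size-with-single : ∀ z → totalSize (with-single (0 , z)) ≡ l
  size-with-single z = fill ((0 , z) ∷ core) spare singles core<l l≤
  select : Dec (+ 2 ∣ᶻ Σᵇ value (with-single e)) → EvenSelection l core (core ++ o ∷ e ∷ spare)
  select (yes ∣Σ) = record
    { chosen = with-single e ; rest = o ∷ drop j spare
    ; perm   = ↭-trans (Permₚ.++⁺ˡ core (Perm.↭-swap o e ↭-refl)) (σ e o)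
    ; size≡  = size-with-single y
    ; counts = λ p → ℕₚ.m≤n⇒m≤1+n (grow e p)
    ; even   = ∣Σ
    ; odd    = ℕₚ.≤-trans 1≤ (grow e 2)
    }
  select (no ∤Σ) = record
    { chosen = with-single o ; rest = e ∷ drop j spare
    ; perm   = σ o e
    ; size≡  = size-with-single x
    ; counts = λ p → ℕₚ.m≤n⇒m≤1+n (grow o p)
    ; even   = odd+odd {x} ∤o λ ∣Σ → ∤Σ (ℤd.∣m∣n⇒∣m+n ∣e ∣Σ)
    ; odd    = ℕₚ.≤-trans 1≤ (grow o 2)
    }

-- It is even on odd single blocks, so these can be added freely without disturbing the parity of
-- its sum. Over a selection of even total size its sum has the parity of the sum of values.
parity-proxy : Block → ℤ
parity-proxy b = + size b ℤ.+ value b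

Σ-parity-proxy : ∀ bs → Σᵇ parity-proxy bs ≡ + totalSize bs ℤ.+ Σᵇ value bs
Σ-parity-proxy []       = refl
Σ-parity-proxy (b ∷ bs) = begin
  parity-proxy b ℤ.+ Σᵇ parity-proxy bs                          ≡⟨ cong (λ v → parity-proxy b ℤ.+ v) (Σ-parity-proxy bs) ⟩
  + size b ℤ.+ value b ℤ.+ (+ totalSize bs ℤ.+ Σᵇ value bs)      ≡⟨ eq (+ size b) (value b) (+ totalSize bs) (Σᵇ value bs) ⟩
  + size b ℤ.+ + totalSize bs ℤ.+ (value b ℤ.+ Σᵇ value bs)      ≡⟨ cong (λ v → v ℤ.+ (value b ℤ.+ Σᵇ value bs)) (sym (ℤₚ.pos-+ (size b) (totalSize bs))) ⟩
  + totalSize (b ∷ bs) ℤ.+ Σᵇ value (b ∷ bs)                     ∎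
  where
  open ≡-Reasoning
  eq : ∀ s x t y → s ℤ.+ x ℤ.+ (t ℤ.+ y) ≡ s ℤ.+ t ℤ.+ (x ℤ.+ y)
  eq = solve-∀

parity-proxy-sound : ∀ {l} → + 2 ∣ᶻ + l → ∀ bs → totalSize bs ≡ l → + 2 ∣ᶻ Σᵇ parity-proxy bs → + 2 ∣ᶻ Σᵇ value bs
parity-proxy-sound ∣l bs refl h = ℤd.∣m+n∣m⇒∣n (subst (+ 2 ∣ᶻ_) (Σ-parity-proxy bs) h) ∣l

2∤1 : ¬ (+ 2 ∣ᶻ 1ℤ)
2∤1 = prime-∤1 prime[2]

odd-singles : ∀ {bs} → All Single bs → All (Nonzero 2) bs → All (λ b → + 2 ∣ᶻ parity-proxy b) bs
odd-singles [] [] = []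
odd-singles {(_ , x) ∷ _} (refl ∷ ss) (h ∷ hs) = odd+odd {1ℤ} {x} 2∤1 h ∷ odd-singles ss hs

even-selection-↭ : ∀ {l core as bs} → as ↭ bs → EvenSelection l core bs → EvenSelection l core as
even-selection-↭ σ s = record
  { chosen = chosen ; rest = rest ; perm = ↭-trans σ perm ; size≡ = size≡ ; counts = counts ; even = even ; odd = odd }
  where open EvenSelection s

even-selection-core : ∀ {l core as} b → EvenSelection l (b ∷ core) as → EvenSelection l core as
even-selection-core {core = core} b s = record
  { chosen = chosen ; rest = rest ; perm = perm ; size≡ = size≡
  ; counts = λ p → ℕₚ.≤-trans (ℕₚ.≤-trans (ℕₚ.m≤n+m (count p core) (count p (b ∷ [])))
                                           (ℕₚ.≤-reflexive (sym (count-++ {p} (b ∷ []) {core}))))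
                              (counts p)
  ; even = even ; odd = odd }
  where open EvenSelection s

count-even : ∀ core {bs} → All (λ b → ¬ Nonzero 2 b) bs → count 2 (core ++ bs) ≡ count 2 core
count-even core h = trans (count-++ core) (trans (cong (λ n → count 2 core + n) (count-zero h)) (ℕₚ.+-identityʳ _))

-- If all spare blocks have the same parity, `value` or `parity-proxy` is even on each of them.
-- Otherwise an odd and an even one are exchanged, which requires an odd core block: with a single
-- odd spare block the count supplies it, and with several one of them joins the core. That move and
-- the exchange use the two free places.
select-sorted : ∀ {l core} odds evens → + 2 ∣ᶻ + l →
  All Single (odds ++ evens) → All (Nonzero 2) odds → All (λ b → ¬ Nonzero 2 b) evens →
  2 + totalSize core ≤ l → l ℕ.< length core + length (odds ++ evens) →
  2 ≤ count 2 (core ++ odds ++ evens) → EvenSelection l core (core ++ odds ++ evens)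
select-sorted {core = core} [] evens ∣l ss os es core≤ l< 2≤ =
  select-uniform value (λ _ _ h → h) ss (All.map (λ {b} → decidable-stable (+ 2 ∣ᶻ? value b)) es)
    (ℕₚ.<-trans (ℕₚ.n<1+n _) core≤) l< (inj₁ (subst (2 ≤_) (count-even core es) 2≤))
select-sorted {l} {core} (o ∷ odds) [] ∣l ss os es core≤ l< 2≤ =
  select-uniform parity-proxy (parity-proxy-sound ∣l) ss
    (odd-singles ss (subst (All (Nonzero 2)) (sym (Listₚ.++-identityʳ (o ∷ odds))) os))
    (ℕₚ.<-trans (ℕₚ.n<1+n _) core≤) l< (inj₂ (o , odds ++ [] , refl , All.head os))
select-sorted {l} {core} (o ∷ []) (e ∷ evens) ∣l ss (∤o ∷ []) (¬∤e ∷ es) core≤ l< 2≤ =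
  select-mixed ss ∤o ¬∤e 1≤count (ℕₚ.<-trans (ℕₚ.n<1+n _) core≤) l≤
  where
  open ℕₚ.≤-Reasoning
  l≤ : l ≤ suc (totalSize core + length evens)
  l≤ = ℕ.s≤s⁻¹ (begin
    suc l                                          ≤⟨ l< ⟩
    length core + suc (suc (length evens))         ≤⟨ ℕₚ.+-monoˡ-≤ (suc (suc (length evens))) (length≤totalSize core) ⟩
    totalSize core + suc (suc (length evens))      ≡⟨ ℕₚ.+-suc (totalSize core) (suc (length evens)) ⟩
    suc (totalSize core + suc (length evens))      ≡⟨ cong suc (ℕₚ.+-suc (totalSize core) (length evens)) ⟩
    suc (suc (totalSize core + length evens))      ∎)
  1≤count : 1 ≤ count 2 core
  1≤count = ℕ.s≤s⁻¹ (begin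
    2                                        ≤⟨ 2≤ ⟩
    count 2 (core ++ o ∷ e ∷ evens)          ≡⟨ cong (count 2) (sym (Listₚ.++-assoc core (o ∷ []) (e ∷ evens))) ⟩
    count 2 ((core ++ o ∷ []) ++ e ∷ evens)  ≡⟨ count-even (core ++ o ∷ []) (¬∤e ∷ es) ⟩
    count 2 (core ++ o ∷ [])                 ≡⟨ count-++ core ⟩
    count 2 core + count 2 (o ∷ [])          ≤⟨ ℕₚ.+-monoʳ-≤ (count 2 core) (count≤length {2} (o ∷ [])) ⟩
    count 2 core + 1                         ≡⟨ ℕₚ.+-comm (count 2 core) 1 ⟩
    suc (count 2 core)                       ∎)
select-sorted {l} {core} (o′@(.0 , x) ∷ o ∷ odds) (e ∷ evens) ∣l (refl ∷ s ∷ ss) (∤o′ ∷ ∤o ∷ _) (¬∤e ∷ _) core≤ l< _ =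
  even-selection-core o′ (even-selection-↭ σ
    (select-mixed {core = o′ ∷ core} {o} {e} {odds ++ evens} ss′ ∤o ¬∤e 1≤count core≤ l≤))
  where
  τ : odds ++ e ∷ evens ↭ e ∷ odds ++ evens
  τ = Permₚ.shift e odds evens
  ss′ : All Single (o ∷ e ∷ odds ++ evens)
  ss′ = s ∷ Permₚ.All-resp-↭ τ ss
  σ : core ++ o′ ∷ o ∷ odds ++ e ∷ evens ↭ (o′ ∷ core) ++ o ∷ e ∷ odds ++ evens
  σ = ↭-trans (Permₚ.shift o′ core _) (↭-prep o′ (Permₚ.++⁺ˡ core (↭-prep o τ)))
  1≤count : 1 ≤ count 2 (o′ ∷ core)
  1≤count = ℕₚ.≤-trans (s≤s z≤n) (ℕₚ.≤-reflexive (sym (cong length (Listₚ.filter-accept (nonzero? 2) {o′} {core} ∤o′))))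
  l≤ : l ≤ suc (suc (totalSize core) + length (odds ++ evens))
  l≤ = ℕ.s≤s⁻¹ (begin
    suc l                                                 ≤⟨ l< ⟩
    length core + suc (suc (length (odds ++ e ∷ evens)))  ≡⟨ cong (λ n → length core + suc (suc n)) (Permₚ.↭-length τ) ⟩
    length core + suc (suc (suc n))                       ≤⟨ ℕₚ.+-monoˡ-≤ _ (length≤totalSize core) ⟩
    totalSize core + (3 + n)                              ≡⟨ +-swap (totalSize core) 3 n ⟩
    3 + (totalSize core + n)                              ∎)
    where
    open ℕₚ.≤-Reasoning
    n = length (odds ++ evens)

select-even : ∀ {l core spare} → + 2 ∣ᶻ + l → All Single spare →
  2 + totalSize core ≤ l → l ℕ.< length core + length spare →
  2 ≤ count 2 (core ++ spare) → EvenSelection l core (core ++ spare)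
select-even {l} {core} {spare} ∣l ss core≤ l< 2≤ =
  even-selection-↭ (Permₚ.++⁺ˡ core σ)
    (select-sorted (filter (nonzero? 2) spare) (filter (zero? 2) spare) ∣l (Permₚ.All-resp-↭ σ ss)
      (Allₚ.all-filter (nonzero? 2) spare) (Allₚ.all-filter (zero? 2) spare)
      core≤ (subst (λ n → l ℕ.< length core + n) (Permₚ.↭-length σ) l<)
      (subst (2 ≤_) (count-↭ {2} (Permₚ.++⁺ˡ core σ)) 2≤))
  where
  σ : spare ↭ filter (nonzero? 2) spare ++ filter (zero? 2) spare
  σ = filter-split (nonzero? 2) spare

-- From counts to weights, and the induction on the prime factors.

filter-nonempty⇒any : ∀ {A : Set} {P : A → Set} (P? : Decidable P) xs → 1 ≤ length (filter P? xs) → Any P xs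
filter-nonempty⇒any P? (x ∷ xs) 1≤ with P? x
... | yes px = here px
... | no  _  = there (filter-nonempty⇒any P? xs 1≤)

count⇒any : ∀ {p bs} → 1 ≤ count p bs → Any (λ x → ¬ (+ p ∣ᶻ x)) (map value bs)
count⇒any {p} {bs} 1≤ = Anyₚ.map⁺ (filter-nonempty⇒any (nonzero? p) bs 1≤)

count⇒solvable : ∀ {p bs} → Prime p → p ≢ 2 → 2 ≤ count p bs → Solvable (+ p) (map value bs)
count⇒solvable {p} {bs} pp p≢2 2≤
  with filter (nonzero? p) bs | filter-split (nonzero? p) bs | Allₚ.all-filter (nonzero? p) bs | 2≤
... | b ∷ c ∷ _ | σ | nb ∷ nc ∷ _ | _     = solvable-↭ (↭-sym (Permₚ.map⁺ value σ)) (solvable-odd pp p≢2 nb nc)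
... | _ ∷ []    | _ | _           | s≤s ()

locally-solvable : ∀ {p bs} → Prime p → p ≢ 2 → 2 ≤ count p bs → LocallySolvable (map value bs) p
locally-solvable {p} {bs} pp p≢2 2≤ = count⇒solvable {bs = bs} pp p≢2 2≤ , count⇒any {bs = bs} (ℕₚ.≤-trans (s≤s z≤n) 2≤)

-- Every prime now has enough nonzero blocks. Without the factor 2, filling the protected core up to
-- size `l` suffices; with it, the filling must also have even sum, because weights modulo 2 offer
-- no choice.
dense-reaches : ∀ {ps as l} → All Prime ps → + 2 ∣ᶻ + l → All (λ p → ¬ Few as p) ps →
  l + length ps ≤ length as → 2 * excess as + sum (map cost ps) + 2 ≤ l → Reaches (+ product ps) as l
dense-reaches {ps} {as} {l} pps ∣l ¬few length≥ bound = by-parity (Any.any? (2 ℕₚ.≟_) ps)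
  where
  open Protection (protect {as} ¬few)
  core+2≤ : 2 + totalSize core ≤ l
  core+2≤ = ℕₚ.≤-trans (ℕₚ.≤-reflexive (ℕₚ.+-comm 2 (totalSize core))) (ℕₚ.≤-trans (ℕₚ.+-monoˡ-≤ 2 core≤) bound)
  length-as : length as ≡ length core + length spare
  length-as = trans (Permₚ.↭-length perm) (Listₚ.length-++ core)
  by-parity : Dec (2 ∈ ps) → Reaches (+ product ps) as l
  by-parity (no 2∉ps) = solvable⇒reaches chosen (drop j spare)
      (↭-trans perm (↭-reflexive (trans (cong (core ++_) (sym (Listₚ.take++drop≡id j spare)))
                                        (sym (Listₚ.++-assoc core (take j spare) (drop j spare))))))
      (fill core spare singles (ℕₚ.≤-trans (ℕₚ.m≤n+m _ 2) core+2≤) l≤)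
      (solvable-product pps (All.tabulate local))
    where
    j = l ℕ.∸ totalSize core
    chosen = core ++ take j spare
    l≤ : l ≤ totalSize core + length spare
    l≤ = begin
      l                              ≤⟨ ℕₚ.≤-trans (ℕₚ.m≤m+n l (length ps)) length≥ ⟩
      length as                      ≡⟨ length-as ⟩
      length core + length spare     ≤⟨ ℕₚ.+-monoˡ-≤ (length spare) (length≤totalSize core) ⟩
      totalSize core + length spare  ∎
      where open ℕₚ.≤-Reasoning
    local : ∀ {p} → p ∈ ps → LocallySolvable (map value chosen) p
    local {p} p∈ps = locally-solvable (All.lookup pps p∈ps) p≢2 (begin
      2                                      ≤⟨ ℕₚ.n≤1+n 2 ⟩
      3                                      ≤⟨ All.lookup protected p∈ps p≢2 ⟩
      count p core                           ≤⟨ ℕₚ.m≤m+n _ _ ⟩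
      count p core + count p (take j spare)  ≡⟨ sym (count-++ core) ⟩
      count p chosen                         ∎)
      where
      open ℕₚ.≤-Reasoning
      p≢2 : p ≢ 2
      p≢2 refl = 2∉ps p∈ps
  by-parity (yes 2∈ps) = solvable⇒reaches (chosen selection) (rest selection)
      (↭-trans perm (EvenSelection.perm selection)) (size≡ selection)
      (solvable-product pps (All.tabulate local))
    where
    open EvenSelection using (chosen; rest; size≡; counts; even; odd)
    selection : EvenSelection l core (core ++ spare)
    selection = select-even ∣l singles core+2≤
      (begin
        suc l                       ≡⟨ ℕₚ.+-comm 1 l ⟩
        -- The presence of 2 makes `ps` nonempty, whence the strict inequality that allows one block
        -- to be dropped.
        l + 1                       ≤⟨ ℕₚ.+-monoʳ-≤ l (nonempty 2∈ps) ⟩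
        l + length ps               ≤⟨ length≥ ⟩
        length as                   ≡⟨ length-as ⟩
        length core + length spare  ∎)
      (subst (2 ≤_) (count-↭ {2} perm) (ℕₚ.≰⇒> λ c≤1 → All.lookup ¬few 2∈ps (inj₁ c≤1)))
      where
      open ℕₚ.≤-Reasoning
      nonempty : ∀ {qs} → 2 ∈ qs → 1 ≤ length qs
      nonempty (here _)  = s≤s z≤n
      nonempty (there _) = s≤s z≤n
    local : ∀ {p} → p ∈ ps → LocallySolvable (map value (chosen selection)) p
    local {p} p∈ps with p ℕₚ.≟ 2
    ... | yes refl = solvable-even (even selection) , count⇒any {bs = chosen selection} (odd selection)
    ... | no  p≢2  = locally-solvable (All.lookup pps p∈ps) p≢2
                       (ℕ.s≤s⁻¹ (ℕₚ.≤-trans (All.lookup protected p∈ps p≢2) (counts selection p)))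

extract : ∀ {A : Set} {P : A → Set} {xs} → Any P xs → ∃₂ λ x ys → xs ↭ x ∷ ys × P x
extract {xs = x ∷ xs} (here px)  = x , xs , ↭-refl , px
extract {xs = x ∷ xs} (there h) =
  let y , ys , σ , py = extract h
  in  y , x ∷ ys , ↭-trans (↭-prep x σ) (Perm.↭-swap x y ↭-refl) , py

-- Both inequalities survive a compression: the first loses at most one on the right and exactly one
-- on the left, and in the second the cost of the removed prime covers the new excess. The number
-- `m` carries the recursion, as the remaining primes are known only up to permutation.
blocks-reach : ∀ m {ps as l} → length ps ≡ m → All Prime ps → + 2 ∣ᶻ + l →
  l + length ps ≤ length as → 2 * excess as + sum (map cost ps) + 2 ≤ l → Reaches (+ product ps) as l
blocks-reach m {ps} {as} {l} len pps ∣l length≥ bound with Any.any? (few? as) ps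
... | no ¬few = dense-reaches pps ∣l (Allₚ.¬Any⇒All¬ ps ¬few) length≥ bound
... | yes few with extract few
... | p , qs , σ , few-p with m | trans (sym (Permₚ.↭-length σ)) len | Permₚ.All-resp-↭ σ pps
... | suc m′ | refl | pp ∷ pqs =
  subst (λ n → Reaches (+ n) as l) (sym (product-↭ σ)) (reaches (blocks-reach m′ refl pqs ∣l length≥′ bound′))
  where
  open Compression (compress {bs = as} pp pqs few-p)
  length≥′ : l + length qs ≤ length blocks
  length≥′ = ℕ.s≤s⁻¹ (begin
    suc (l + length qs)   ≡⟨ sym (ℕₚ.+-suc l (length qs)) ⟩
    l + suc (length qs)   ≡⟨ cong (λ n → l + n) (sym (Permₚ.↭-length σ)) ⟩
    l + length ps         ≤⟨ length≥ ⟩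
    length as             ≤⟨ length≤ ⟩
    suc (length blocks)   ∎)
    where open ℕₚ.≤-Reasoning
  bound′ : 2 * excess blocks + sum (map cost qs) + 2 ≤ l
  bound′ = begin
    2 * excess blocks + sum (map cost qs) + 2           ≤⟨ ℕₚ.+-monoˡ-≤ 2 (ℕₚ.+-monoˡ-≤ (sum (map cost qs)) excess≤) ⟩
    2 * excess as + cost p + sum (map cost qs) + 2      ≡⟨ cong (_+ 2) (ℕₚ.+-assoc (2 * excess as) (cost p) _) ⟩
    2 * excess as + sum (map cost (p ∷ qs)) + 2         ≡⟨ cong (λ n → 2 * excess as + n + 2) (sym (sum-↭ (Permₚ.map⁺ cost σ))) ⟩
    2 * excess as + sum (map cost ps) + 2               ≤⟨ bound ⟩
    l                                                   ∎
    where open ℕₚ.≤-Reasoning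

-- The Gao constant

unit⇒U : ∀ {n a} → Unit (+ n) a → U n a
unit⇒U {n} {a} (unit b h) =
  b , congruent (subst (λ c → + n ∣ᶻ c ℤ.- 1ℤ) (ℤₚ.*-comm a b) h) , congruent h

U⇒unit : ∀ {n a} → U n a → Unit (+ n) a
U⇒unit (b , _ , congruent h) = unit b h

singles : ∀ {l} → Vector ℤ l → List Block
singles x = List.tabulate (λ i → 0 , x i)

excess-singles : ∀ {l} (x : Vector ℤ l) → excess (singles x) ≡ 0
excess-singles {zero}  x = refl
excess-singles {suc l} x = excess-singles (x ∘ suc)

SelectionOf : ℕ → ∀ {l} → Vector ℤ l → ℕ → ℤ → Set
SelectionOf n {l} x r v =
  ∃[ I ] card I ≡ r × ∃[ a ] (∀ i → i ∈ₛ I → Unit (+ n) (a i)) × weightedSum n {l} I a x ≡ v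

rep⇒selection : ∀ {n l r v} (x : Vector ℤ l) → Rep (+ n) (singles x) r v → SelectionOf n x r v
rep⇒selection {l = zero}  x [] = Vec.[] , refl , Vector.[] , (λ ()) , refl
rep⇒selection {n} {suc l} x (skip r) with rep⇒selection (x ∘ suc) r
-- The weight 0 at the skipped index is a placeholder that the sum never reads.
... | I , refl , a , units , refl = outside Vec.∷ I , refl , 0ℤ Vector.∷ a , units′ , ℤₚ.+-identityˡ _
  where
  units′ : ∀ i → i ∈ₛ (outside Vec.∷ I) → Unit (+ n) ((0ℤ Vector.∷ a) i)
  units′ (suc i) (there i∈I) = units i i∈I
rep⇒selection {n} {suc l} x (_∷_ {a₀} u r) with rep⇒selection (x ∘ suc) r
... | I , refl , a , units , refl = inside Vec.∷ I , refl , a₀ Vector.∷ a , units′ , refl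
  where
  units′ : ∀ i → i ∈ₛ (inside Vec.∷ I) → Unit (+ n) ((a₀ Vector.∷ a) i)
  units′ zero    here        = u
  units′ (suc i) (there i∈I) = units i i∈I

card⇒nonempty : ∀ {l} (I : Subset l) → 1 ≤ card I → Nonempty I
card⇒nonempty (inside  Vec.∷ I) _  = zero , here
card⇒nonempty (outside Vec.∷ I) 1≤ = let i , i∈I = card⇒nonempty I 1≤ in suc i , there i∈I

-- This starts the induction at excess 0. With `P = product ps`, an odd prime adds 3 on the left,
-- while `2 P` becomes at least `6 P = 4 P + 2 P` with `P` positive. A factor 2 costs nothing.
cost-bound : ∀ {ps} → All Prime ps → sum (map cost ps) + 2 ≤ 2 * product ps
cost-bound [] = ℕₚ.≤-refl
cost-bound {p ∷ ps} (pp ∷ pps) with p ℕₚ.≟ 2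
... | yes refl = ℕₚ.≤-trans (cost-bound pps) (ℕₚ.*-monoʳ-≤ 2 (ℕₚ.m≤m+n (product ps) _))
... | no  p≢2  = begin
    cost p + sum (map cost ps) + 2      ≡⟨ trans (ℕₚ.+-assoc (cost p) _ 2) (cong (_+ _) (cost-odd p≢2)) ⟩
    3 + (sum (map cost ps) + 2)         ≤⟨ ℕₚ.+-mono-≤ 3≤ (cost-bound pps) ⟩
    2 * (2 * product ps) + 2 * product ps ≡⟨ eq ⟩
    2 * (3 * product ps)                ≤⟨ ℕₚ.*-monoʳ-≤ 2 (ℕₚ.*-monoˡ-≤ (product ps) 3≤p) ⟩
    2 * (p * product ps)                ∎
  where
  open ℕₚ.≤-Reasoning
  3≤p : 3 ≤ p
  3≤p = ℕₚ.≤∧≢⇒< (ℕ.nonTrivial⇒n>1 p {{prime⇒nonTrivial pp}}) (p≢2 ∘ sym)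
  3≤ : 3 ≤ 2 * (2 * product ps)
  3≤ = ℕₚ.≤-trans (ℕₚ.n≤1+n 3) (ℕₚ.*-monoʳ-≤ 2 (ℕₚ.*-monoʳ-≤ 2 (productOfPrimes≥1 pps)))
  eq : 2 * (2 * product ps) + 2 * product ps ≡ 2 * (3 * product ps)
  eq = trans (sym (ℕₚ.*-distribˡ-+ 2 (2 * product ps) (product ps))) (cong (2 *_) (ℕₚ.+-comm (2 * product ps) _))

gao-property : ∀ {qs l} → All Prime qs → l ≡ 2 * product qs + suc (length qs) →
               GaoProperty (2 * product qs) (U (2 * product qs)) l
gao-property {qs} pqs refl x =
  -- The list `2 ∷ qs` has product `n` and one prime more than `qs`, which accounts for the `suc` in
  -- the length; the cost of 2 is 0, so `cost-bound` for `qs` is enough.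
  let _ , r , n∣v         = blocks-reach _ {2 ∷ qs} {singles x} refl (prime[2] ∷ pqs) 2∣n length≥ bound
      I , card≡ , a , units , sum≡ = rep⇒selection x r
  in  I , card≡ , card⇒nonempty I (subst (1 ≤_) (sym card≡) 1≤n) , a ,
      (λ i i∈I → unit⇒U (units i i∈I)) ,
      congruent (subst (+ n ∣ᶻ_) (trans (sym sum≡) (sym (ℤₚ.+-identityʳ _))) n∣v)
  where
  n = 2 * product qs
  2∣n : + 2 ∣ᶻ + n
  2∣n = ℤd.∣ᵤ⇒∣ (ℕd.m∣m*n (product qs))
  1≤n : 1 ≤ n
  1≤n = ℕₚ.≤-trans (productOfPrimes≥1 pqs) (ℕₚ.m≤m+n (product qs) _)
  length≥ : n + suc (length qs) ≤ length (singles x)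
  length≥ = ℕₚ.≤-reflexive (sym (Listₚ.length-tabulate (λ i → 0 , x i)))
  bound : 2 * excess (singles x) + sum (map cost qs) + 2 ≤ n
  bound = subst (λ e → 2 * e + sum (map cost qs) + 2 ≤ n) (sym (excess-singles x)) (cost-bound pqs)

gao-property-suc : ∀ {n A l} → GaoProperty n A l → GaoProperty n A (suc l)
gao-property-suc {n} {A} gao x with gao (x ∘ suc)
... | I , card≡ , (i , i∈I) , a , a∈A , congruent h =
  outside Vec.∷ I , card≡ , (suc i , there i∈I) , 0ℤ Vector.∷ a , a∈A′ ,
  congruent (subst (λ v → + n ∣ᶻ v ℤ.- 0ℤ) (sym (ℤₚ.+-identityˡ (weightedSum n I a (x ∘ suc)))) h)
  where
  a∈A′ : ∀ i → i ∈ₛ (outside Vec.∷ I) → A ((0ℤ Vector.∷ a) i)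
  a∈A′ (suc i) (there i∈I) = a∈A i i∈I

-- By this monotonicity, one sequence without a zero-sum subsequence excludes every shorter length
-- as well.
gao-property-≤ : ∀ {n A l l′} → l ℕ.≤′ l′ → GaoProperty n A l → GaoProperty n A l′
gao-property-≤ (ℕ.≤′-reflexive refl) gao = gao
gao-property-≤ {n} {A} (ℕ.≤′-step l≤l′)     gao = gao-property-suc {n} {A} (gao-property-≤ {n} {A} l≤l′ gao)

-- The lower bound: weighted sums over the sequence `S`.

module _ (n : ℕ) where

  weightedSum-cong : ∀ {l} I a {x y : Vector ℤ l} → (∀ i → x i ≡ y i) → weightedSum n I a x ≡ weightedSum n I a y
  weightedSum-cong Vec.[] a eq = refl
  weightedSum-cong (inside Vec.∷ I) a eq =
    cong₂ ℤ._+_ (cong (λ z → a zero ℤ.* z) (eq zero)) (weightedSum-cong I (a ∘ suc) (eq ∘ suc))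
  weightedSum-cong (outside Vec.∷ I) a eq = cong (λ z → 0ℤ ℤ.+ z) (weightedSum-cong I (a ∘ suc) (eq ∘ suc))

  weightedSum-* : ∀ {l} I a c (x : Vector ℤ l) → weightedSum n I a (λ i → c ℤ.* x i) ≡ c ℤ.* weightedSum n I a x
  weightedSum-* Vec.[] a c x = sym (ℤₚ.*-zeroʳ c)
  weightedSum-* (inside Vec.∷ I) a c x =
    trans (cong (λ z → a zero ℤ.* (c ℤ.* x zero) ℤ.+ z) (weightedSum-* I (a ∘ suc) c (x ∘ suc)))
          (eq (a zero) c (x zero) _)
    where
    eq : ∀ a c x w → a ℤ.* (c ℤ.* x) ℤ.+ c ℤ.* w ≡ c ℤ.* (a ℤ.* x ℤ.+ w)
    eq = solve-∀
  weightedSum-* (outside Vec.∷ I) a c x =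
    trans (cong (λ z → 0ℤ ℤ.+ z) (weightedSum-* I (a ∘ suc) c (x ∘ suc))) (eq c _)
    where
    eq : ∀ c w → 0ℤ ℤ.+ c ℤ.* w ≡ c ℤ.* (0ℤ ℤ.+ w)
    eq = solve-∀

  weightedSum-outside : ∀ k {l} (J : Subset l) a x →
    weightedSum n (Vec.replicate k outside Vec.++ J) a x ≡ weightedSum n J (a ∘ (k ↑ʳ_)) (x ∘ (k ↑ʳ_))
  weightedSum-outside zero    J a x = refl
  weightedSum-outside (suc k) J a x =
    trans (ℤₚ.+-identityˡ _) (weightedSum-outside k J (a ∘ suc) (x ∘ suc))

  weightedSum-zero : ∀ {l} I a → weightedSum n {l} I a (λ _ → 0ℤ) ≡ 0ℤ
  weightedSum-zero I a = trans (weightedSum-* I a 0ℤ (λ _ → 0ℤ)) refl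

card-outside : ∀ k {l} (J : Subset l) → card (Vec.replicate k outside Vec.++ J) ≡ card J
card-outside zero    J = refl
card-outside (suc k) J = card-outside k J

∈-outside : ∀ k {l} {J : Subset l} {j} → j ∈ₛ J → (k ↑ʳ j) ∈ₛ (Vec.replicate k outside Vec.++ J)
∈-outside zero    j∈J = j∈J
∈-outside (suc k) j∈J = there (∈-outside k j∈J)

++-suc : ∀ {k l} (x : Vector ℤ (suc k)) (y : Vector ℤ l) i → (x Vector.++ y) (suc i) ≡ ((x ∘ suc) Vector.++ y) i
++-suc {k} x y i with splitAt k i
... | inj₁ _ = refl
... | inj₂ _ = refl

*-++ : ∀ {k l} c (x : Vector ℤ k) (y : Vector ℤ l) i →
       c ℤ.* (x Vector.++ y) i ≡ ((λ j → c ℤ.* x j) Vector.++ (λ j → c ℤ.* y j)) i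
*-++ {k} c x y i with splitAt k i
... | inj₁ _ = refl
... | inj₂ _ = refl

-- With the factor `∏ p` on the tail, removing the first entry and dividing by `p zero` gives a
-- sequence of the same shape for the remaining primes. `S` is the case where `s` consists of `m`
-- ones followed by zeros.
extended : ∀ {k l} → Vector ℕ k → Vector ℤ k → Vector ℤ l → Vector ℤ (k + l)
extended p b s = leadingTerms p b Vector.++ (λ j → + ∏ p ℤ.* s j)

extended-suc : ∀ {k l} (p : Vector ℕ (suc k)) (b : Vector ℤ (suc k)) (s : Vector ℤ l) i →
               extended p b s (suc i) ≡ + p zero ℤ.* extended (p ∘ suc) (b ∘ suc) s i
extended-suc {k} p b s i = trans (++-suc (leadingTerms p b) (λ j → + ∏ p ℤ.* s j) i) (trans step 
  (sym (*-++ (+ p zero) (leadingTerms (p ∘ suc) (b ∘ suc)) (λ j → + ∏ (p ∘ suc) ℤ.* s j) i)))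
  where
  step : ((leadingTerms p b ∘ suc) Vector.++ (λ j → + ∏ p ℤ.* s j)) i ≡
         ((λ j → + p zero ℤ.* leadingTerms (p ∘ suc) (b ∘ suc) j) Vector.++ (λ j → + p zero ℤ.* (+ ∏ (p ∘ suc) ℤ.* s j))) i
  step = Vectorₚ.++-cong _ _
    (λ j → factor (product (List.take (toℕ j) (Vector.toList (p ∘ suc)))) (b (suc j)))
    (λ j → factor (∏ (p ∘ suc)) (s j)) i
    where
    factor : ∀ q z → + (p zero * q) ℤ.* z ≡ + p zero ℤ.* (+ q ℤ.* z)
    factor q z = trans (cong (λ v → v ℤ.* z) (ℤₚ.pos-* (p zero) q)) (ℤₚ.*-assoc (+ p zero) (+ q) z)

-- Reading the sum modulo the successive primes excludes the leading terms one after the other.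
leading-excluded : ∀ n {k l} (p : Vector ℕ k) (b : Vector ℤ k) (s : Vector ℤ l) I a →
  (∀ i → Prime (p i)) → (∀ i → Coprime (b i) (+ p i)) → (∀ i j → j ∈ₛ I → Unit (+ p i) (a j)) →
  + ∏ p ∣ᶻ weightedSum n I a (extended p b s) → ∃[ J ] I ≡ Vec.replicate k outside Vec.++ J
leading-excluded n {zero} p b s I a pp cop units h = I , refl
leading-excluded n {suc k} p b s (o Vec.∷ I) a pp cop units h = by-side o refl
  where
  p₀ = p zero
  W = weightedSum n I (a ∘ suc) (extended (p ∘ suc) (b ∘ suc) s)
  tail≡ : weightedSum n I (a ∘ suc) (extended p b s ∘ suc) ≡ + p₀ ℤ.* W
  tail≡ = trans (weightedSum-cong n I (a ∘ suc) (extended-suc p b s))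
                (weightedSum-* n I (a ∘ suc) (+ p₀) (extended (p ∘ suc) (b ∘ suc) s))
  p₀∣∏ : + p₀ ∣ᶻ + ∏ p
  p₀∣∏ = ℤd.∣ᵤ⇒∣ (ℕd.m∣m*n (∏ (p ∘ suc)))
  by-side : ∀ o′ → o ≡ o′ → ∃[ J ] o Vec.∷ I ≡ Vec.replicate (suc k) outside Vec.++ J
  -- All later entries are multiples of `p₀`, so `p₀` would divide the first weight times `b zero`,
  -- a product of two units modulo `p₀`.
  by-side inside refl = contradiction p₀∣head (unit⇒∤ (pp zero) (unit-product (units zero zero here) unit-b))
    where
    unit-b : Unit (+ p₀) (1ℤ ℤ.* b zero)
    unit-b = subst (Unit (+ p₀)) (sym (ℤₚ.*-identityˡ (b zero))) (coprime⇒unit {b zero} (λ {i} → cop zero {i}))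
    p₀∣head : + p₀ ∣ᶻ a zero ℤ.* (1ℤ ℤ.* b zero)
    p₀∣head = ℤd.∣m+n∣n⇒∣m (ℤd.∣-trans p₀∣∏ h) (subst (+ p₀ ∣ᶻ_) (sym tail≡) (ℤd.∣m⇒∣m*n W ℤd.∣-refl))
  by-side outside refl =
    let J , I≡ = leading-excluded n (p ∘ suc) (b ∘ suc) s I (a ∘ suc) (pp ∘ suc) (cop ∘ suc)
                   (λ i j j∈I → units (suc i) (suc j) (there j∈I)) ∏∣W
    in  J , cong (outside Vec.∷_) I≡
    where
    ∏∣W : + ∏ (p ∘ suc) ∣ᶻ W
    ∏∣W = ℤd.*-cancelˡ-∣ (+ p₀) {{prime⇒nonZero (pp zero)}}
      (subst₂ _∣ᶻ_ (ℤₚ.pos-* p₀ (∏ (p ∘ suc))) (trans (ℤₚ.+-identityˡ _) tail≡) h)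

ones : ∀ m r → Vector ℤ (m + r)
ones m r = replicate m 1ℤ Vector.++ replicate r 0ℤ

odd-weights-sum : ∀ n m r a → (∀ i → Unit (+ 2) (a i)) →
                  + 2 ∣ᶻ weightedSum n (full {m + r}) a (ones m r) ℤ.- + m
odd-weights-sum n zero r a units =
  subst (λ v → + 2 ∣ᶻ v ℤ.- 0ℤ) (sym (weightedSum-zero n full a)) (divides 0ℤ refl)
odd-weights-sum n (suc m) r a units = subst (+ 2 ∣ᶻ_) eq
  (ℤd.∣m∣n⇒∣m+n (2∤⇒2∣-1 (unit⇒∤ prime[2] (units zero))) (odd-weights-sum n m r (a ∘ suc) (units ∘ suc)))
  where
  W = weightedSum n full (a ∘ suc) (ones m r)
  eq′ : ∀ a w m → (a ℤ.- 1ℤ) ℤ.+ (w ℤ.- m) ≡ a ℤ.* 1ℤ ℤ.+ w ℤ.- (1ℤ ℤ.+ m)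
  eq′ = solve-∀
  eq : (a zero ℤ.- 1ℤ) ℤ.+ (W ℤ.- + m) ≡ weightedSum n full a (ones (suc m) r) ℤ.- + suc m
  eq = trans (eq′ (a zero) W (+ m))
    (cong (λ w → a zero ℤ.* 1ℤ ℤ.+ w ℤ.- + suc m)
      (weightedSum-cong n full (a ∘ suc) (λ i → sym (++-suc (replicate (suc m) 1ℤ) (replicate r 0ℤ) i))))

S-extended : ∀ {k} m r h (p : Vector ℕ k) b → h ≡ ∏ p → ∀ i →
             (leadingTerms p b Vector.++ (replicate m (+ h) Vector.++ replicate r 0ℤ)) i ≡ extended p b (ones m r) i
S-extended m r h p b refl = Vectorₚ.++-cong (leadingTerms p b) (leadingTerms p b) (λ _ → refl) λ j → sym
  (trans (*-++ (+ h) (replicate m 1ℤ) (replicate r 0ℤ) j)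
         (Vectorₚ.++-cong (λ _ → + h ℤ.* 1ℤ) (replicate m (+ h)) (λ _ → ℤₚ.*-identityʳ (+ h)) (λ _ → ℤₚ.*-zeroʳ (+ h)) j))

factor∣∏ : ∀ {k} (p : Vector ℕ k) i → p i ∣ ∏ p
factor∣∏ p zero    = ℕd.m∣m*n (∏ (p ∘ suc))
factor∣∏ p (suc i) = ℕd.∣n⇒∣m*n (p zero) (factor∣∏ (p ∘ suc) i)

S-no-zero-sum : ∀ {k} (p : Vector ℕ k) → (∀ i → Prime (p i)) → ∀ m → ¬ (2 ∣ m) → m ≤ 2 * ∏ p →
  ∀ b → (∀ i → Coprime (b i) (+ p i)) →
  ¬ HasWeightedZeroSumOfLength (2 * ∏ p) (U (2 * ∏ p)) (2 * ∏ p) (S (2 * ∏ p) m p b)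
S-no-zero-sum {k} p pp m ∤m m≤n b cop (I , card≡ , _ , a , a∈U , congruent h) =
  no-tail (leading-excluded n p b s I a pp cop
    (λ i j j∈I → unit-weaken (ℤd.∣ᵤ⇒∣ (ℕd.∣n⇒∣m*n 2 (factor∣∏ p i))) (units j j∈I))
    (ℤd.∣-trans (ℤd.∣ᵤ⇒∣ (ℕd.n∣m*n 2)) n∣W))
  where
  n = 2 * ∏ p
  r = n ℕ.∸ m
  s = ones m r
  units : ∀ j → j ∈ₛ I → Unit (+ n) (a j)
  units j j∈I = U⇒unit (a∈U j j∈I)
  n/2≡∏ : n ℕ./ 2 ≡ ∏ p
  n/2≡∏ = trans (cong (ℕ._/ 2) (ℕₚ.*-comm 2 (∏ p))) (m*n/n≡m (∏ p) 2)
  n∣W : + n ∣ᶻ weightedSum n I a (extended p b s)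
  n∣W = subst (+ n ∣ᶻ_) (trans (ℤₚ.+-identityʳ _)
          (weightedSum-cong n I a (S-extended m r (n ℕ./ 2) p b n/2≡∏))) h
  no-tail : ¬ (∃[ J ] I ≡ Vec.replicate k outside Vec.++ J)
  no-tail (J , I≡) = ∤m (ℤd.∣⇒∣ᵤ (subst (+ 2 ∣ᶻ_) (eq (weightedSum n full a′ s) (+ m))
      (ℤd.∣m∣n⇒∣m-n 2∣W′ (odd-weights-sum n m r a′ units′))))
    where
    open ≡-Reasoning
    a′ : Vector ℤ (m + r)
    a′ j = a (k ↑ʳ j)
    -- The `n` chosen indices all lie among the `m + r = n` trailing ones, so every trailing term is
    -- chosen.
    J≡full : J ≡ full
    J≡full = ∣p∣≡n⇒p≡⊤ (begin
      card J                                   ≡⟨ sym (card-outside k J) ⟩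
      card (Vec.replicate k outside Vec.++ J)  ≡⟨ cong card (sym I≡) ⟩
      card I                                   ≡⟨ card≡ ⟩
      n                                        ≡⟨ sym (ℕₚ.m+[n∸m]≡n m≤n) ⟩
      m + r                                    ∎)
    units′ : ∀ j → Unit (+ 2) (a′ j)
    units′ j = unit-weaken (ℤd.∣ᵤ⇒∣ (ℕd.m∣m*n (∏ p)))
      (units (k ↑ʳ j) (subst ((k ↑ʳ j) ∈ₛ_) (sym I≡) (∈-outside k (subst (j ∈ₛ_) (sym J≡full) ∈⊤))))
    W≡ : weightedSum n I a (extended p b s) ≡ + ∏ p ℤ.* weightedSum n full a′ s
    W≡ = begin
      weightedSum n I a (extended p b s)
        ≡⟨ cong (λ I → weightedSum n I a (extended p b s)) I≡ ⟩
      weightedSum n (Vec.replicate k outside Vec.++ J) a (extended p b s)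
        ≡⟨ weightedSum-outside n k J a (extended p b s) ⟩
      weightedSum n J a′ (λ j → extended p b s (k ↑ʳ j))
        ≡⟨ weightedSum-cong n J a′ (Vectorₚ.lookup-++ʳ (leadingTerms p b) (λ j → + ∏ p ℤ.* s j)) ⟩
      weightedSum n J a′ (λ j → + ∏ p ℤ.* s j)
        ≡⟨ weightedSum-* n J a′ (+ ∏ p) s ⟩
      + ∏ p ℤ.* weightedSum n J a′ s
        ≡⟨ cong (λ J → + ∏ p ℤ.* weightedSum n J a′ s) J≡full ⟩
      + ∏ p ℤ.* weightedSum n full a′ s ∎
    -- Cancelling `∏ p` from `2 ∏ p` leaves the parity of a sum of `m` odd weights, so `m` would be
    -- even.
    2∣W′ : + 2 ∣ᶻ weightedSum n full a′ s
    2∣W′ = ℤd.*-cancelʳ-∣ (+ ∏ p) {{productOfPrimes≢0 (Allₚ.tabulate⁺ pp)}}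
      (subst₂ _∣ᶻ_ (ℤₚ.pos-* 2 (∏ p)) (trans W≡ (ℤₚ.*-comm (+ ∏ p) _)) n∣W)
    eq : ∀ w m → w ℤ.- (w ℤ.- m) ≡ m
    eq = solve-∀

lemma4 : ∀ (k : ℕ) → 1 ≤ k →
    ∀ (p : Vector ℕ k) → (∀ i → Prime (p i)) →
    ∀ (n : ℕ) → n ≡ 2 * ∏ p →
    ∀ (m : ℕ) → ¬ (2 ∣ m) → 1 ≤ m → m ≤ n →
    ∀ (b : Vector ℤ k) → (∀ i → Coprime (b i) (+ p i)) →
    IsGaoExtremal n (U n) (S n m p b)
lemma4 k _ p pp n refl m ∤m _ m≤n b cop =
  -- The constant is one more than the length of `S`, and `S` itself witnesses its minimality.
  suc l , (s≤s z≤n , gao-property pqs length≡ , minimal) , refl , no-zero-sum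
  where
  l = k + (m + (n ℕ.∸ m))
  pqs : All Prime (Vector.toList p)
  pqs = Allₚ.tabulate⁺ pp
  length≡ : suc l ≡ n + suc (length (Vector.toList p))
  length≡ = begin
    suc (k + (m + (n ℕ.∸ m)))          ≡⟨ cong (λ j → suc (k + j)) (ℕₚ.m+[n∸m]≡n m≤n) ⟩
    suc k + n                          ≡⟨ ℕₚ.+-comm (suc k) n ⟩
    n + suc k                          ≡⟨ cong (λ j → n + suc j) (sym (Listₚ.length-tabulate p)) ⟩
    n + suc (length (Vector.toList p)) ∎
    where open ≡-Reasoning
  no-zero-sum : ¬ HasWeightedZeroSumOfLength n (U n) n (S n m p b)
  no-zero-sum = S-no-zero-sum p pp m ∤m m≤n b cop
  minimal : ∀ l′ → 1 ≤ l′ → GaoProperty n (U n) l′ → suc l ≤ l′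
  minimal l′ _ gao = ℕₚ.≰⇒> λ l′≤l →
    no-zero-sum (gao-property-≤ {n} {U n} (ℕₚ.≤⇒≤′ l′≤l) gao (S n m p b))
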